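{- For every $\varepsilon>0$ there exist constants $p_0=p_0(\varepsilon)$ and $c=c(\varepsilon)>0$, depending only on $\varepsilon$, such that for every prime $p\ge p_0$ and all (nonempty) intervals $\mathcal{I}_1,\mathcal{I}_2,\mathcal{I}_3$ in $\mathbb{F}_p^*$ with $|\mathcal{I}_i|<p^{1/8}$ for $i=1,2,3$, $$c\,\bigl(|\mathcal{I}_1|\cdot|\mathcal{I}_2|\cdot|\mathcal{I}_3|\bigr)^{1-\varepsilon}\le |\mathcal{I}_1\cdot\mathcal{I}_2\cdot\mathcal{I}_3|\le |\mathcal{I}_1|\cdot|\mathcal{I}_2|\cdot|\mathcal{I}_3| .$$ (That is, $|\mathcal{I}_1\cdot\mathcal{I}_2\cdot\mathcal{I}_3|=(|\mathcal{I}_1|\cdot|\mathcal{I}_2|\cdot|\mathcal{I}_3|)^{1-o(1)}$.)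
   Context: $\mathbb{F}_p$ is the field of residue classes modulo the prime $p$ and $\mathbb{F}_p^*=\mathbb{F}_p\setminus\{0\}$. An interval in $\mathbb{F}_p^*$ is a set of residue classes of consecutive integers $L+1,\dots,L+N$ (with $L\in\mathbb{Z}$, $1\le N<p$), none of which is divisible by $p$; its length $|\mathcal{I}|$ is its number of elements $N$. The product set is $\mathcal{I}_1\cdot\mathcal{I}_2\cdot\mathcal{I}_3=\{xyz: x\in\mathcal{I}_1,\,y\in\mathcal{I}_2,\,z\in\mathcal{I}_3\}\subset\mathbb{F}_p^*$. -}

module Defs where

open import Data.Fin using (Fin; toℕ; fromℕ<)
open import Data.Fin.Properties using (any?) renaming (_≟_ to _≟ᶠ_)
open import Data.Fin.Subset using (Subset; _∈_)
open import Data.Fin.Subset.Properties using (_∈?_)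
open import Data.Integer as ℤ using (ℤ; +_; -[1+_]; _%ℕ_)
open import Data.Integer.Divisibility using (_∣_)
open import Data.Integer.DivMod using (n%ℕd<d)
open import Data.Nat as ℕ using (ℕ; suc; NonZero)
open import Data.Nat.DivMod using (_mod_)
open import Data.Product using (∃; ∃-syntax; _×_; _,_; swap)
open import Data.Rational as ℚ using (ℚ; 0ℚ; _-_; _<_; _≤_; ↥_; ↧ₙ_)
import Data.Rational.Properties as ℚ
open import Algebra.Definitions.RawSemiring ℚ.+-*-rawSemiring using (_^_)
open import Algebra.Properties.AbelianGroup ℚ.+-0-abelianGroup using (⁻¹-anti-homo-//; xyx⁻¹≈y)
open import Data.Sum as Sum using (_⊎_)
open import Data.Vec using (tabulate)
open import Function using (_⇔_)
open import Relation.Binary.PropositionalEquality using (_≡_; sym; trans; cong; subst)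
open import Relation.Nullary using (¬_; does)
open import Relation.Nullary.Decidable using (_×-dec_)

-- Dedekind reals: lower q means q < x, and upper q means x < q.
record ℝ : Set₁ where
  field
    lower upper     : ℚ → Set
    lower-inhabited : ∃ lower
    upper-inhabited : ∃ upper
    lower-closed    : ∀ {p q} → p < q → lower q → lower p
    upper-closed    : ∀ {p q} → p < q → upper p → upper q
    lower-open      : ∀ {p} → lower p → ∃[ q ] p < q × lower q
    upper-open      : ∀ {q} → upper q → ∃[ p ] p < q × upper p
    disjoint        : ∀ {q} → ¬ (lower q × upper q)
    located         : ∀ {p q} → p < q → lower p ⊎ upper q

open ℝ

Positive : ℝ → Set
Positive x = lower x 0ℚ

private
  sub-sub : ∀ q r → q - (q - r) ≡ r
  sub-sub q r = trans (cong (q ℚ.+_) (⁻¹-anti-homo-// q r))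
                (trans (sym (ℚ.+-assoc q r (ℚ.- q))) (xyx⁻¹≈y q r))

  sub-anti : ∀ q {r s} → r < s → q - s < q - r
  sub-anti q r<s = ℚ.+-monoʳ-< q (ℚ.neg-antimono-< r<s)

infixl 6 _⊖_

_⊖_ : ℚ → ℝ → ℝ
q ⊖ x = record
  { lower           = λ r → upper x (q - r)
  ; upper           = λ r → lower x (q - r)
  ; lower-inhabited = let u , x<u = upper-inhabited x
                      in q - u , subst (upper x) (sym (sub-sub q u)) x<u
  ; upper-inhabited = let l , l<x = lower-inhabited x
                      in q - l , subst (lower x) (sym (sub-sub q l)) l<x
  ; lower-closed    = λ r<s → upper-closed x (sub-anti q r<s)
  ; upper-closed    = λ r<s → lower-closed x (sub-anti q r<s)
  ; lower-open      = λ {r} x<q-r → let s , s<q-r , x<s = upper-open x x<q-r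
                      in q - s
                       , subst (_< q - s) (sub-sub q r) (sub-anti q s<q-r)
                       , subst (upper x) (sym (sub-sub q s)) x<s
  ; upper-open      = λ {r} q-r<x → let s , q-r<s , s<x = lower-open x q-r<x
                      in q - s
                       , subst (q - s <_) (sub-sub q r) (sub-anti q q-r<s)
                       , subst (lower x) (sym (sub-sub q s)) s<x
  ; disjoint        = λ r → disjoint x (swap r)
  ; located         = λ r<s → Sum.swap (located x (sub-anti q r<s))
  }

fromℕ : ℕ → ℚ
fromℕ n = + n ℚ./ 1

-- c · n ^ (u / v) ≤ m for c > 0 and n ≥ 1, raised to the power v; a negative
-- power of n is moved to the right-hand side.
ScaledPowerℚ≤ : ℚ → ℕ → ℚ → ℕ → Set
ScaledPowerℚ≤ c n r m with ↥ r
... | + k      = c ^ ↧ₙ r ℚ.* fromℕ n ^ k ≤ fromℕ m ^ ↧ₙ r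
... | -[1+ k ] = c ^ ↧ₙ r ≤ fromℕ m ^ ↧ₙ r ℚ.* fromℕ n ^ suc k

-- c · n ^ x ≤ m for c > 0, n ≥ 1 and real x, where n ^ x is the supremum of
-- n ^ r over the rationals r < x.
ScaledPower≤ : ℚ → ℕ → ℝ → ℕ → Set
ScaledPower≤ c n x m = ∀ r → lower x r → ScaledPowerℚ≤ c n r m

-- Fin p represents the residue classes modulo p.
module _ {p : ℕ} .{{_ : NonZero p}} where

  residue : ℤ → Fin p
  residue z = fromℕ< (n%ℕd<d z p)

  infixl 7 _⊗_

  _⊗_ : Fin p → Fin p → Fin p
  x ⊗ y = (toℕ x ℕ.* toℕ y) mod p

  -- An interval in the nonzero residue classes: the classes of L+1, …, L+N.
  IsInterval : Subset p → Set
  IsInterval I = ∃[ L ] ∃[ N ]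
    1 ℕ.≤ N × N ℕ.< p ×
    (∀ i → 1 ℕ.≤ i → i ℕ.≤ N → ¬ (+ p ∣ L ℤ.+ + i)) ×
    (∀ x → x ∈ I ⇔ (∃[ i ] 1 ℕ.≤ i × i ℕ.≤ N × x ≡ residue (L ℤ.+ + i)))

  productSet : Subset p → Subset p → Subset p → Subset p
  productSet I J K = tabulate λ w → does
    (any? λ x → any? λ y → any? λ z →
      x ∈? I ×-dec y ∈? J ×-dec z ∈? K ×-dec w ≟ᶠ x ⊗ y ⊗ z)

{-# OPTIONS --safe #-}

-- By the inequalities of Cauchy-Schwarz and Hölder it suffices to bound, for a single
-- interval L + 1, …, L + N, the number of solutions of
--   (L + x₁) (L + x₂) (L + x₃) ≡ (L + y₁) (L + y₂) (L + y₃)  (mod p)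
-- by C N ^ (3 + ε).  The polynomials (s + x₁) (s + x₂) (s + x₃) - (s + y₁) (s + y₂) (s + y₃)
-- = a s² + b s + c of the solutions have the common root L modulo p and coefficients of size
-- O(N), O(N²), O(N³).  If 1000 N⁸ < p, the resultant of any two of them is smaller than p,
-- hence zero, so all of them share a rational root or are multiples of one quadratic.  Either
-- way there is a fixed polynomial Q of degree 1 or 2, not vanishing at -1, …, -N, with
-- Q(-x₁) Q(-x₂) Q(-x₃) = ± Q(-y₁) Q(-y₂) Q(-y₃), and the divisor bound leaves N ^ ε choices
-- of x for each y.  The condition 1000 N⁸ < p is reached by replacing each interval by a
-- subinterval of at least a fifth of its length.
module Submission where

open import Defs
open import Data.Fin.Subset using (Subset; ∣_∣)
open import Data.Nat using (ℕ; NonZero; _*_; _^_; _≤_; _<_)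
open import Data.Nat.Primality using (Prime)
open import Data.Product using (∃-syntax; _×_)
open import Data.Rational as ℚ using (ℚ; 0ℚ; 1ℚ)

open import Algebra.Bundles using (CommutativeRing)
import Algebra.Properties.CommutativeSemiring.Exp as Exp
open import Data.Bool using (true; if_then_else_)
open import Data.Empty using (⊥; ⊥-elim)
open import Data.Fin as Fin using (Fin; toℕ)
open import Data.Fin.Properties using (any?; toℕ-fromℕ<; toℕ<n) renaming (_≟_ to _≟ᶠ_)
open import Data.Fin.Subset using (inside; outside) renaming (_∈_ to _∈ˢ_)
open import Data.Fin.Subset.Properties using (_∈?_; drop-there)
open import Data.Integer as ℤ using (ℤ; +_; -[1+_]; +[1+_]; 0ℤ; 1ℤ; _%ℕ_)
  renaming (_+_ to _+ᶻ_; _*_ to _*ᶻ_; _-_ to _-ᶻ_; -_ to -ᶻ_; ∣_∣ to abs)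
open import Data.Integer.Divisibility.Signed as ℤ∣ using () renaming (_∣_ to _∣ᶻ_)
open import Data.Integer.DivMod using (n%ℕd<d; a≡a%ℕn+[a/ℕn]*n)
import Data.Integer.Properties as ℤ
open import Data.Integer.Tactic.RingSolver using () renaming (solve-∀ to ℤ-ring)
open import Data.List as List
  using (List; []; _∷_; _++_; map; length; filter; upTo; applyUpTo; allFin; cartesianProduct)
open import Data.List.Membership.Propositional using (_∈_)
open import Data.List.Membership.Propositional.Properties
  using ( ∈-upTo⁺; ∈-upTo⁻; ∈-applyUpTo⁺; ∈-applyUpTo⁻; ∈-filter⁺; ∈-map⁻; ∈-allFin
        ; ∈-cartesianProduct⁺; ∈-cartesianProduct⁻)
open import Data.List.Properties using (length-map; length-++; length-applyUpTo; map-tabulate)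
open import Data.List.Relation.Unary.All as All using (All; []; _∷_)
import Data.List.Relation.Unary.All.Properties as All
open import Data.List.Relation.Unary.AllPairs using ([]; _∷_)
open import Data.List.Relation.Unary.Any using (here; there)
open import Data.List.Relation.Unary.Unique.Propositional using (Unique)
import Data.List.Relation.Unary.Unique.Propositional.Properties as Unique
open import Data.Nat as ℕ
  using ( zero; suc; _+_; _∸_; _⊔_; _/_; _%_; ⌊_/2⌋; ⌈_/2⌉; z≤n; s≤s; s≤s⁻¹; _≤?_
        ; >-nonZero; >-nonZero⁻¹; nonTrivial⇒n>1; n>1⇒nonTrivial)
open import Data.Nat.Coprimality using (Coprime; coprime-Bézout; coprime-divisor)
open import Data.Nat.Divisibility
  using (_∣_; _∣?_; divides; *-cancelˡ-∣; ∣1⇒≡1; ∣⇒≤; ∣-refl; ∣m⇒∣m*n; ∣n⇒∣m*n)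
open import Data.Nat.DivMod
  using (m≡m%n+[m/n]*n; m%n<n; m/n*n≤m; m/n≤m; m≥n⇒m/n>0; m*n/n≡m)
open import Data.Nat.GCD using (module Bézout)
open import Data.Nat.Induction using (<-rec)
open import Data.Nat.ListAction using (sum; product)
open import Data.Nat.ListAction.Properties using (∈⇒∣product)
open import Data.Nat.Primality
  using ( _Rough_; 2-rough; rough⇒≤; ∤⇒rough-suc; rough∧∣⇒rough; rough∧∣⇒prime
        ; prime⇒nonZero; prime⇒nonTrivial; prime⇒irreducible; euclidsLemma)
open import Data.Nat.Primality.Factorisation using (factorise; PrimeFactorisation)
open import Data.Nat.Properties hiding (_≟_)
open import Data.Nat.Tactic.RingSolver using () renaming (solve-∀ to ℕ-ring)
open import Data.Product using (_,_; proj₁; proj₂)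
open import Data.Rational using (mkℚ; ↥_; ↧ₙ_)
import Data.Rational.Properties as ℚ
open import Algebra.Definitions.RawSemiring ℚ.+-*-rawSemiring using () renaming (_^_ to _^ℚ_)
open import Data.Rational.Unnormalised as ℚᵘ using (mkℚᵘ; *≡*; *≤*; *<*)
import Data.Rational.Unnormalised.Properties as ℚᵘ
open import Data.Sum using (_⊎_; inj₁; inj₂; [_,_]′)
open import Data.Vec using ([]; _∷_; tabulate; here; there)
open import Data.Vec.Properties using (lookup∘tabulate; lookup⇒[]=; []=⇒lookup)
open import Function using (_∘_; Equivalence)
open import Relation.Binary.PropositionalEquality
open import Relation.Nullary using (¬_; Dec; yes; no; does; ¬?; contradiction)
open import Relation.Nullary.Decidable using (True; toWitness; decidable-stable; dec-true; _×-dec_)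
open import Relation.Unary using (Decidable)

-- Real exponents are avoided: an estimate X ≤ C N^(r/m) is stated as X^m ≤ C' N^r with natural
-- numbers only. The exponents add up as follows. Norms |Q(-x₁) Q(-x₂) Q(-x₃)| are at most (24 N⁴)³,
-- so their number T of divisors satisfies T^m ≤ C N^12. Two of the three coordinates are chosen
-- through divisors, so T enters squared and a single interval has energy O(N^(3 + 24/m)). Hölder
-- turns this into (N₁ N₂ N₃)^(1 + 8/m) for three intervals, and m = 8 (j + 1) leaves a loss of
-- exponent 1/(j + 1), which is less than ε for a suitable j. Hölder's inequality is obtained
-- without multiplicative characters. The equation is rewritten as an equality of two fractions
-- modulo p with the variables separated, and Cauchy-Schwarz is applied repeatedly with different
-- choices of what goes to which side.

private variable S T Φ Ψ : Set


-- Indicators and finite sums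

𝟙 : Dec Φ → ℕ
𝟙 d = if does d then 1 else 0

𝟙-yes : (d : Dec Φ) → Φ → 𝟙 d ≡ 1
𝟙-yes (yes _) _ = refl
𝟙-yes (no ¬p) p = contradiction p ¬p

𝟙-no : (d : Dec Φ) → ¬ Φ → 𝟙 d ≡ 0
𝟙-no (yes p) ¬p = contradiction p ¬p
𝟙-no (no _) _ = refl

𝟙-positive : (d : Dec Φ) → 1 ≤ 𝟙 d → Φ
𝟙-positive (yes p) _ = p

𝟙-≤ : (d : Dec Φ) {n : ℕ} → (Φ → 1 ≤ n) → 𝟙 d ≤ n
𝟙-≤ (yes p) h = h p
𝟙-≤ (no _) _ = z≤n

𝟙-mono : (d : Dec Φ) (e : Dec Ψ) → (Φ → Ψ) → 𝟙 d ≤ 𝟙 e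
𝟙-mono d e h = 𝟙-≤ d λ p → ≤-reflexive (sym (𝟙-yes e (h p)))

𝟙-cong : (d : Dec Φ) (e : Dec Ψ) → (Φ → Ψ) → (Ψ → Φ) → 𝟙 d ≡ 𝟙 e
𝟙-cong d e h k = ≤-antisym (𝟙-mono d e h) (𝟙-mono e d k)

∑ : List S → (S → ℕ) → ℕ
∑ xs f = sum (map f xs)

∑-mono∈ : (xs : List S) {f g : S → ℕ} → (∀ {x} → x ∈ xs → f x ≤ g x) → ∑ xs f ≤ ∑ xs g
∑-mono∈ []       h = z≤n
∑-mono∈ (x ∷ xs) h = +-mono-≤ (h (here refl)) (∑-mono∈ xs (h ∘ there))

∑-mono : (xs : List S) {f g : S → ℕ} → (∀ x → f x ≤ g x) → ∑ xs f ≤ ∑ xs g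
∑-mono xs h = ∑-mono∈ xs λ {x} _ → h x

∑-cong∈ : (xs : List S) {f g : S → ℕ} → (∀ {x} → x ∈ xs → f x ≡ g x) → ∑ xs f ≡ ∑ xs g
∑-cong∈ xs h = ≤-antisym (∑-mono∈ xs λ m → ≤-reflexive (h m)) (∑-mono∈ xs λ m → ≤-reflexive (sym (h m)))

∑-cong : (xs : List S) {f g : S → ℕ} → (∀ x → f x ≡ g x) → ∑ xs f ≡ ∑ xs g
∑-cong xs h = ∑-cong∈ xs λ {x} _ → h x

∑-const : (xs : List S) (k : ℕ) → ∑ xs (λ _ → k) ≡ length xs * k
∑-const []       k = refl
∑-const (x ∷ xs) k = cong (λ n → k + n) (∑-const xs k)

∑-≤ : (xs : List S) {f : S → ℕ} (k : ℕ) → (∀ {x} → x ∈ xs → f x ≤ k) → ∑ xs f ≤ length xs * k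
∑-≤ xs k h = ≤-trans (∑-mono∈ xs h) (≤-reflexive (∑-const xs k))

∑-*ˡ : (xs : List S) (k : ℕ) (f : S → ℕ) → ∑ xs (λ x → k * f x) ≡ k * ∑ xs f
∑-*ˡ []       k f = sym (*-zeroʳ k)
∑-*ˡ (x ∷ xs) k f = trans (cong (λ ν → k * f x + ν) (∑-*ˡ xs k f)) (sym (*-distribˡ-+ k (f x) (∑ xs f)))

∑-*ʳ : (xs : List S) (f : S → ℕ) (k : ℕ) → ∑ xs (λ x → f x * k) ≡ ∑ xs f * k
∑-*ʳ xs f k = trans (∑-cong xs λ x → *-comm (f x) k) (trans (∑-*ˡ xs k f) (*-comm k _))

∑-*-∑ : (xs : List S) (ys : List T) (f : S → ℕ) (g : T → ℕ) →
  ∑ xs f * ∑ ys g ≡ ∑ xs λ x → ∑ ys λ y → f x * g y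
∑-*-∑ xs ys f g = trans (sym (∑-*ʳ xs f (∑ ys g))) (∑-cong xs λ x → sym (∑-*ˡ ys (f x) g))

∑-zero : (xs : List S) → ∑ xs (λ _ → 0) ≡ 0
∑-zero xs = trans (∑-const xs 0) (*-zeroʳ (length xs))

∑-+ : (xs : List S) (f g : S → ℕ) → ∑ xs (λ x → f x + g x) ≡ ∑ xs f + ∑ xs g
∑-+ []       f g = refl
∑-+ (x ∷ xs) f g = trans (cong (λ ν → f x + g x + ν) (∑-+ xs f g)) (swap-middle (f x) (g x) (∑ xs f) (∑ xs g))
  where
  swap-middle : ∀ a b c d → a + b + (c + d) ≡ a + c + (b + d)
  swap-middle = ℕ-ring

∑-swap : (xs : List S) (ys : List T) (f : S → T → ℕ) →
  (∑ xs λ x → ∑ ys λ y → f x y) ≡ ∑ ys λ y → ∑ xs λ x → f x y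
∑-swap []       ys f = sym (∑-zero ys)
∑-swap (x ∷ xs) ys f = trans (cong (λ ν → ∑ ys (f x) + ν) (∑-swap xs ys f))
  (sym (∑-+ ys (f x) (λ y → ∑ xs λ x′ → f x′ y)))

∑-map : (h : S → T) (xs : List S) (f : T → ℕ) → ∑ (map h xs) f ≡ ∑ xs (f ∘ h)
∑-map h []       f = refl
∑-map h (x ∷ xs) f = cong (λ ν → f (h x) + ν) (∑-map h xs f)

∑-++ : (xs ys : List S) (f : S → ℕ) → ∑ (xs ++ ys) f ≡ ∑ xs f + ∑ ys f
∑-++ []       ys f = refl
∑-++ (x ∷ xs) ys f = trans (cong (λ ν → f x + ν) (∑-++ xs ys f)) (sym (+-assoc (f x) (∑ xs f) (∑ ys f)))

∑-cartesianProduct : (xs : List S) (ys : List T) (f : S × T → ℕ) →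
  ∑ (cartesianProduct xs ys) f ≡ ∑ xs λ x → ∑ ys λ y → f (x , y)
∑-cartesianProduct []       ys f = refl
∑-cartesianProduct (x ∷ xs) ys f = trans (∑-++ (map (x ,_) ys) (cartesianProduct xs ys) f)
  (cong₂ _+_ (∑-map (x ,_) ys f) (∑-cartesianProduct xs ys f))

∑-≥ : {xs : List S} {x : S} (f : S → ℕ) → x ∈ xs → f x ≤ ∑ xs f
∑-≥ f (here refl) = m≤m+n _ _
∑-≥ {xs = y ∷ xs} f (there m) = ≤-trans (∑-≥ f m) (m≤n+m _ (f y))

∑-positive : (xs : List S) {f : S → ℕ} → 1 ≤ ∑ xs f → ∃[ x ] x ∈ xs × 1 ≤ f x
∑-positive (x ∷ xs) {f} h with 1 ≤? f x
... | yes q = x , here refl , q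
... | no ¬q with y , m , q ← ∑-positive xs {f} (subst (λ k → 1 ≤ k + ∑ xs f) (n<1⇒n≡0 (≰⇒> ¬q)) h)
  = y , there m , q

∑-all-zero : (xs : List S) {f : S → ℕ} → (∀ {x} → x ∈ xs → f x ≡ 0) → ∑ xs f ≡ 0
∑-all-zero xs h = trans (∑-cong∈ xs h) (∑-zero xs)

∑-single : {xs : List S} → Unique xs → {x : S} → x ∈ xs → {f : S → ℕ} →
  (∀ {y} → y ∈ xs → y ≢ x → f y ≡ 0) → ∑ xs f ≡ f x
∑-single (x∉ ∷ _) (here refl) {f} h = trans
  (cong (λ ν → f _ + ν) (∑-all-zero _ λ m → h (there m) λ { refl → All.lookup x∉ m refl })) (+-identityʳ _)
∑-single (y∉ ∷ u) (there m) h = cong₂ _+_ (h (here refl) λ { refl → All.lookup y∉ m refl })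
  (∑-single u m (h ∘ there))

-- Cauchy-Schwarz over the natural numbers

square-cancel-≤ : ∀ {m n} → m * m ≤ n * n → m ≤ n
square-cancel-≤ {m} {n} h = ≮⇒≥ λ n<m → <⇒≱ (*-mono-< n<m n<m) h

-- The two sides differ by (u - v)²; ordering `u` and `v` first writes this as `d * d` without
-- subtraction.
4uv≤[u+v]² : ∀ u v → 4 * (u * v) ≤ (u + v) * (u + v)
4uv≤[u+v]² u v with ≤-total u v
... | inj₁ u≤v with d , refl ← m≤n⇒∃[o]m+o≡n u≤v = subst (4 * (u * (u + d)) ≤_) (expand u d) (m≤m+n _ (d * d))
  where
  expand : ∀ u d → 4 * (u * (u + d)) + d * d ≡ (u + (u + d)) * (u + (u + d))
  expand = ℕ-ring
... | inj₂ v≤u with d , refl ← m≤n⇒∃[o]m+o≡n v≤u = subst (4 * ((v + d) * v) ≤_) (expand v d) (m≤m+n _ (d * d))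
  where
  expand : ∀ u d → 4 * ((u + d) * u) + d * d ≡ ((u + d) + u) * ((u + d) + u)
  expand = ℕ-ring

am-gm : ∀ t u v → t * t ≤ u * v → 2 * t ≤ u + v
am-gm t u v h = square-cancel-≤ (begin
  (2 * t) * (2 * t) ≡⟨ regroup t ⟩
  4 * (t * t)       ≤⟨ *-monoʳ-≤ 4 h ⟩
  4 * (u * v)       ≤⟨ 4uv≤[u+v]² u v ⟩
  (u + v) * (u + v) ∎)
  where
  open ≤-Reasoning
  regroup : ∀ t → (2 * t) * (2 * t) ≡ 4 * (t * t)
  regroup = ℕ-ring

-- Induction on the list. The cross term 2abH is at most a²G + b²F by `am-gm`, whose hypothesis
-- (abH)² ≤ a²G · b²F is the induction hypothesis H² ≤ FG times a²b².
cauchy-schwarz : (xs : List S) (f g : S → ℕ) →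
  ∑ xs (λ x → f x * g x) * ∑ xs (λ x → f x * g x) ≤ ∑ xs (λ x → f x * f x) * ∑ xs (λ x → g x * g x)
cauchy-schwarz []       f g = z≤n
cauchy-schwarz (x ∷ xs) f g = begin
  (a * b + H) * (a * b + H)                          ≡⟨ expandˡ a b H ⟩
  a * a * (b * b) + 2 * (a * b * H) + H * H          ≤⟨ +-mono-≤ (+-monoʳ-≤ (a * a * (b * b)) cross) ih ⟩
  a * a * (b * b) + (a * a * G + b * b * F) + F * G  ≡⟨ expandʳ a b F G ⟩
  (a * a + F) * (b * b + G)                          ∎
  where
  open ≤-Reasoning
  a = f x
  b = g x
  H = ∑ xs λ x → f x * g x
  F = ∑ xs λ x → f x * f x
  G = ∑ xs λ x → g x * g x
  ih = cauchy-schwarz xs f g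
  expandˡ : ∀ a b H → (a * b + H) * (a * b + H) ≡ a * a * (b * b) + 2 * (a * b * H) + H * H
  expandˡ = ℕ-ring
  expandʳ : ∀ a b F G → a * a * (b * b) + (a * a * G + b * b * F) + F * G ≡ (a * a + F) * (b * b + G)
  expandʳ = ℕ-ring
  regroupˡ : ∀ a b H → a * b * H * (a * b * H) ≡ a * a * (b * b) * (H * H)
  regroupˡ = ℕ-ring
  regroupʳ : ∀ a b F G → a * a * (b * b) * (F * G) ≡ a * a * G * (b * b * F)
  regroupʳ = ℕ-ring
  cross : 2 * (a * b * H) ≤ a * a * G + b * b * F
  cross = am-gm (a * b * H) (a * a * G) (b * b * F) (begin
    a * b * H * (a * b * H)       ≡⟨ regroupˡ a b H ⟩
    a * a * (b * b) * (H * H)     ≤⟨ *-monoʳ-≤ (a * a * (b * b)) ih ⟩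
    a * a * (b * b) * (F * G)     ≡⟨ regroupʳ a b F G ⟩
    a * a * G * (b * b * F)       ∎)

-- The divisor bound

length-filter-split : {P : S → Set} (P? : Decidable P) (xs : List S) →
  length xs ≡ length (filter P? xs) + length (filter (¬? ∘ P?) xs)
length-filter-split P? [] = refl
length-filter-split P? (x ∷ xs) with P? x
... | yes _ = cong suc (length-filter-split P? xs)
... | no _  = trans (cong suc (length-filter-split P? xs)) (sym (+-suc _ _))

quotients : ∀ {q} (ds : List ℕ) → All (q ∣_) ds → ∃[ es ] ds ≡ map (q *_) es
quotients [] [] = [] , refl
quotients {q} (d ∷ ds) (divides e eq ∷ hs) with es , refl ← quotients ds hs =
  e ∷ es , cong (_∷ map (q *_) es) (trans eq (*-comm e q))

-- This is d(n) ≤ T for the divisor function d, phrased through duplicate-free lists so that no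
-- enumeration of the divisors has to be fixed.
DivisorBound : ℕ → ℕ → Set
DivisorBound n T = ∀ {ds} → Unique ds → All (_∣ n) ds → length ds ≤ T

-- Divisors of `q * m` that are multiples of `q` correspond to divisors of `m`; the others are
-- counted among the divisors of `n`. Keeping `n` apart from `m` lets the count for `q ^ e * n` grow
-- by only `T` with each step of `e`.
divisorBound-split : ∀ {q m n T U} .{{_ : NonZero q}} →
  (∀ {d} → d ∣ q * m → ¬ q ∣ d → d ∣ n) →
  DivisorBound n T → DivisorBound m U → DivisorBound (q * m) (T + U)
divisorBound-split {q} {m} {n} {T} {U} coprime-part hT hU {ds} u hs = begin
  length ds                                                       ≡⟨ length-filter-split (q ∣?_) ds ⟩
  length (filter (q ∣?_) ds) + length (filter (¬? ∘ (q ∣?_)) ds)  ≤⟨ +-mono-≤ multiples others ⟩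
  U + T                                                           ≡⟨ +-comm U T ⟩
  T + U                                                           ∎
  where
  open ≤-Reasoning
  others : length (filter (¬? ∘ (q ∣?_)) ds) ≤ T
  others = hT (Unique.filter⁺ (¬? ∘ (q ∣?_)) u)
    (All.zipWith (λ (d∣qm , q∤d) → coprime-part d∣qm q∤d)
      (All.filter⁺ (¬? ∘ (q ∣?_)) hs , All.all-filter (¬? ∘ (q ∣?_)) ds))
  multiples : length (filter (q ∣?_) ds) ≤ U
  multiples with es , eq ← quotients (filter (q ∣?_) ds) (All.all-filter (q ∣?_) ds) = begin
    length (filter (q ∣?_) ds) ≡⟨ cong length eq ⟩
    length (map (q *_) es)     ≡⟨ length-map (q *_) es ⟩
    length es                  ≤⟨ hU (Unique.map⁻ (subst Unique eq (Unique.filter⁺ (q ∣?_) u)))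
                                    (All.map (*-cancelˡ-∣ q)
                                      (All.map⁻ (subst (All (_∣ q * m)) eq (All.filter⁺ (q ∣?_) hs)))) ⟩
    U                          ∎

prime∤⇒coprime : ∀ {q d} → Prime q → ¬ q ∣ d → Coprime d q
prime∤⇒coprime {q} pq q∤d {i} (i∣d , i∣q) with prime⇒irreducible pq i∣q
... | inj₁ i≡1  = i≡1
... | inj₂ refl = contradiction i∣d q∤d

divisorBound-1 : DivisorBound 1 1
divisorBound-1 {[]} _ _ = z≤n
divisorBound-1 {_ ∷ []} _ _ = s≤s z≤n
divisorBound-1 {d ∷ e ∷ _} ((d≢e ∷ _) ∷ _) (h ∷ k ∷ _) = contradiction (trans (∣1⇒≡1 h) (sym (∣1⇒≡1 k))) d≢e

-- The cofactor `n` may again be divisible by `q`, so a list of prime factors can be processed one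
-- by one without grouping equal primes.
divisorBound-prime* : ∀ {q n T} → Prime q → DivisorBound n T → DivisorBound (q * n) (T + T)
divisorBound-prime* {q} pq h = divisorBound-split {{prime⇒nonZero pq}}
  (λ d∣qn q∤d → coprime-divisor (prime∤⇒coprime pq q∤d) d∣qn) h h

divisorBound-prime^* : ∀ {q n T} → Prime q → DivisorBound n T → ∀ e → DivisorBound (q ^ e * n) (suc e * T)
divisorBound-prime^* {q} {n} {T} pq h zero =
  subst₂ DivisorBound (sym (*-identityˡ n)) (sym (+-identityʳ T)) h
divisorBound-prime^* {q} {n} {T} pq h (suc e) =
  subst (λ k → DivisorBound k (suc (suc e) * T)) (sym (*-assoc q (q ^ e) n))
    (divisorBound-split {{prime⇒nonZero pq}} coprime-part h (divisorBound-prime^* pq h e))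
  where
  strip : ∀ e {d} → ¬ q ∣ d → d ∣ q ^ e * n → d ∣ n
  strip zero    {d} q∤d d∣n  = subst (d ∣_) (*-identityˡ n) d∣n
  strip (suc e) {d} q∤d d∣qn = strip e q∤d
    (coprime-divisor (prime∤⇒coprime pq q∤d) (subst (d ∣_) (*-assoc q (q ^ e) n) d∣qn))
  coprime-part : ∀ {d} → d ∣ q * (q ^ e * n) → ¬ q ∣ d → d ∣ n
  coprime-part {d} d∣ q∤d = strip (suc e) q∤d (subst (d ∣_) (sym (*-assoc q (q ^ e) n)) d∣)

^-distribʳ-* : ∀ m n k → (m * n) ^ k ≡ m ^ k * n ^ k
^-distribʳ-* m n zero = refl
^-distribʳ-* m n (suc k) = trans (cong (m * n *_) (^-distribʳ-* m n k)) (interchange m n (m ^ k) (n ^ k))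
  where
  interchange : ∀ a b c d → a * b * (c * d) ≡ a * c * (b * d)
  interchange = ℕ-ring

1+n≤2^n : ∀ n → suc n ≤ 2 ^ n
1+n≤2^n zero = ≤-refl
1+n≤2^n (suc n) = begin
  suc (suc n)   ≤⟨ s≤s (1+n≤2^n n) ⟩
  suc (2 ^ n)   ≤⟨ +-monoˡ-≤ (2 ^ n) (m^n>0 2 n) ⟩
  2 ^ n + 2 ^ n ≡⟨ cong (λ ν → 2 ^ n + ν) (sym (+-identityʳ _)) ⟩
  2 ^ suc n     ∎
  where open ≤-Reasoning

-- Passing from e to ⌊ e / 2 ⌋ turns one factor 1 + e into a factor 2 ^ ⌊ e / 2 ⌋.
expBound : ℕ → ℕ
expBound zero    = 1
expBound (suc m) = 2 ^ suc m * expBound m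

-- The local estimate at a small prime q: 1 + e is the number of divisors of q^e, and 2^e ≤ q^e.
polynomial≤exponential : ∀ m e → suc e ^ m ≤ expBound m * 2 ^ e
polynomial≤exponential zero    e = ≤-trans (m^n>0 2 e) (≤-reflexive (sym (+-identityʳ _)))
polynomial≤exponential (suc m) e = begin
  suc e ^ suc m                                  ≤⟨ ^-monoˡ-≤ (suc m) 1+e≤2[1+h] ⟩
  (2 * suc h) ^ suc m                            ≡⟨ ^-distribʳ-* 2 (suc h) (suc m) ⟩
  2 ^ suc m * (suc h * suc h ^ m)
    ≤⟨ *-monoʳ-≤ (2 ^ suc m) (*-mono-≤ (1+n≤2^n h) (polynomial≤exponential m h)) ⟩
  2 ^ suc m * (2 ^ h * (expBound m * 2 ^ h))     ≡⟨ regroup (2 ^ suc m) (2 ^ h) (expBound m) ⟩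
  expBound (suc m) * (2 ^ h * 2 ^ h)
    ≡⟨ cong (expBound (suc m) *_) (sym (^-distribˡ-+-* 2 h h)) ⟩
  expBound (suc m) * 2 ^ (h + h)                 ≤⟨ *-monoʳ-≤ (expBound (suc m)) (^-monoʳ-≤ 2 h+h≤e) ⟩
  expBound (suc m) * 2 ^ e                       ∎
  where
  open ≤-Reasoning
  h = ⌊ e /2⌋
  h+h≤e : h + h ≤ e
  h+h≤e = ≤-trans (+-monoʳ-≤ h (⌊n/2⌋≤⌈n/2⌉ e)) (≤-reflexive (⌊n/2⌋+⌈n/2⌉≡n e))
  ⌈/2⌉≤suc⌊/2⌋ : ∀ n → ⌈ n /2⌉ ≤ suc ⌊ n /2⌋
  ⌈/2⌉≤suc⌊/2⌋ zero = z≤n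
  ⌈/2⌉≤suc⌊/2⌋ (suc zero) = s≤s z≤n
  ⌈/2⌉≤suc⌊/2⌋ (suc (suc n)) = s≤s (⌈/2⌉≤suc⌊/2⌋ n)
  1+e≤2[1+h] : suc e ≤ 2 * suc h
  1+e≤2[1+h] = begin
    suc e               ≡⟨ cong suc (sym (⌊n/2⌋+⌈n/2⌉≡n e)) ⟩
    suc h + ⌈ e /2⌉     ≤⟨ +-monoʳ-≤ (suc h) (⌈/2⌉≤suc⌊/2⌋ e) ⟩
    suc h + suc h       ≡⟨ cong (λ ν → suc h + ν) (sym (+-identityʳ _)) ⟩
    2 * suc h           ∎
  regroup : ∀ a b c → a * (b * (c * b)) ≡ a * c * (b * b)
  regroup = ℕ-ring

extractPower : ∀ q → 2 ≤ q → ∀ n → 1 ≤ n → ∃[ e ] ∃[ n′ ] n ≡ q ^ e * n′ × ¬ q ∣ n′ × 1 ≤ n′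
extractPower q 2≤q = <-rec _ step
  where
  step : ∀ n → (∀ {m} → m < n → 1 ≤ m → ∃[ e ] ∃[ m′ ] m ≡ q ^ e * m′ × ¬ q ∣ m′ × 1 ≤ m′) →
    1 ≤ n → ∃[ e ] ∃[ n′ ] n ≡ q ^ e * n′ × ¬ q ∣ n′ × 1 ≤ n′
  step n rec 1≤n with q ∣? n
  ... | no q∤n = 0 , n , sym (*-identityˡ n) , q∤n , 1≤n
  ... | yes (divides m@(suc _) refl) with e , m′ , eq , q∤m′ , 1≤m′ ← rec {m} (m<m*n m q 2≤q) (s≤s z≤n) =
    suc e , m′ , trans (*-comm m q) (trans (cong (q *_) eq) (sym (*-assoc q (q ^ e) m′))) , q∤m′ , 1≤m′

-- The bound d(n) ≤ (C n)^(1/m) with the root cleared.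
HasDivisorBound : ℕ → ℕ → ℕ → Set
HasDivisorBound m C n = ∃[ T ] DivisorBound n T × T ^ m ≤ C * n

-- A prime factor `q` at least doubles `n` by the factor 2^m ≤ q while it doubles `T`, so `T ^ m`
-- never outgrows the product and no constant is lost at large primes.
divisorBound-product : ∀ m {qs} → All Prime qs → All (2 ^ m ≤_) qs → HasDivisorBound m 1 (product qs)
divisorBound-product m [] [] = 1 , divisorBound-1 , ≤-reflexive (^-zeroˡ m)
divisorBound-product m {q ∷ qs} (pq ∷ pqs) (2^m≤q ∷ hs) with T , hT , T^m≤ ← divisorBound-product m pqs hs =
  T + T , divisorBound-prime* pq hT , (begin
    (T + T) ^ m          ≡⟨ cong (λ k → (T + k) ^ m) (sym (+-identityʳ T)) ⟩
    (2 * T) ^ m          ≡⟨ ^-distribʳ-* 2 T m ⟩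
    2 ^ m * T ^ m        ≤⟨ *-mono-≤ 2^m≤q T^m≤ ⟩
    q * (1 * product qs) ≡⟨ cong (q *_) (+-identityʳ _) ⟩
    q * product qs       ≡⟨ sym (+-identityʳ _) ⟩
    1 * (q * product qs) ∎)
  where open ≤-Reasoning

divisorBound-2^m-rough : ∀ m n → 1 ≤ n → (2 ^ m) Rough n → HasDivisorBound m 1 n
divisorBound-2^m-rough m n@(suc _) _ rough = subst (HasDivisorBound m 1) (sym isFactorisation)
  (divisorBound-product m factorsPrime (All.tabulate λ {q} q∈ →
    rough⇒≤ {{prime⇒nonTrivial (All.lookup factorsPrime q∈)}}
      (rough∧∣⇒rough rough (subst (q ∣_) (sym isFactorisation) (∈⇒∣product q∈)))))
  where
  open PrimeFactorisation (factorise n {{_}})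

-- Sieving by k = 2, 3, ... below 2^m, where `j` counts the candidates that remain. If `k` divides
-- the `k`-rough number `n`, then `k` is prime; for composite `k` the extracted exponent is 0. Every
-- candidate, prime or composite, is charged one factor `expBound m`.
divisorBound-rough : ∀ m j k → 2 ≤ k → j + k ≡ 2 ^ m → ∀ n → 1 ≤ n → k Rough n →
  HasDivisorBound m (expBound m ^ j) n
divisorBound-rough m zero k _ refl n 1≤n rough = divisorBound-2^m-rough m n 1≤n rough
divisorBound-rough m (suc j) k 2≤k eq n 1≤n rough
  with e , n′ , refl , k∤n′ , 1≤n′ ← extractPower k 2≤k n 1≤n
  with T , hT , T^m≤ ← divisorBound-rough m j (suc k) (m≤n⇒m≤1+n 2≤k) (trans (+-suc j k) eq) n′ 1≤n′
                         (∤⇒rough-suc k∤n′ (rough∧∣⇒rough rough (divides (k ^ e) refl)))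
  = suc e * T , bound e rough , (begin
    (suc e * T) ^ m                              ≡⟨ ^-distribʳ-* (suc e) T m ⟩
    suc e ^ m * T ^ m                            ≤⟨ *-mono-≤ (polynomial≤exponential m e) T^m≤ ⟩
    c * 2 ^ e * (c ^ j * n′)                     ≤⟨ *-monoˡ-≤ (c ^ j * n′) (*-monoʳ-≤ c (^-monoˡ-≤ e 2≤k)) ⟩
    c * k ^ e * (c ^ j * n′)                     ≡⟨ regroup c (k ^ e) (c ^ j) n′ ⟩
    c ^ suc j * (k ^ e * n′)                     ∎)
  where
  open ≤-Reasoning
  c = expBound m
  regroup : ∀ a b d f → a * b * (d * f) ≡ a * d * (b * f)
  regroup = ℕ-ring
  bound : ∀ e → k Rough (k ^ e * n′) → DivisorBound (k ^ e * n′) (suc e * T)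
  bound zero    _ = subst₂ DivisorBound (sym (*-identityˡ n′)) (sym (+-identityʳ T)) hT
  bound (suc e) r = divisorBound-prime^*
    (rough∧∣⇒prime {{n>1⇒nonTrivial 2≤k}} r (divides (k ^ e * n′) (trans (*-assoc k (k ^ e) n′) (*-comm k _)))) hT (suc e)

-- The exponent is the number of candidates 2, ..., 2^m - 1 of the sieve.
divisorConstant : ℕ → ℕ
divisorConstant m = expBound m ^ (2 ^ m ∸ 2)

divisorBound : ∀ m → 1 ≤ m → ∀ n → 1 ≤ n → HasDivisorBound m (divisorConstant m) n
divisorBound m 1≤m n 1≤n =
  divisorBound-rough m (2 ^ m ∸ 2) 2 ≤-refl (m∸n+n≡m (^-monoʳ-≤ 2 1≤m)) n 1≤n 2-rough

-- Divisibility of integers by a prime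

abstract
  infix 4 _∣ᶻ?_
  _∣ᶻ?_ : ∀ k z → Dec (k ∣ᶻ z)
  _∣ᶻ?_ = ℤ∣._∣?_

euclid : ∀ {p} → Prime p → ∀ a b → + p ∣ᶻ a *ᶻ b → (+ p ∣ᶻ a) ⊎ (+ p ∣ᶻ b)
euclid pp a b h with euclidsLemma (abs a) (abs b) pp (subst (_ ∣_) (ℤ.abs-* a b) (ℤ∣.∣⇒∣ᵤ h))
... | inj₁ k = inj₁ (ℤ∣.∣ᵤ⇒∣ k)
... | inj₂ k = inj₂ (ℤ∣.∣ᵤ⇒∣ k)

-- The passage from congruences modulo p to equations over ℤ.
∣∧small⇒≡0 : ∀ {p} z → abs z < p → + p ∣ᶻ z → z ≡ 0ℤ
∣∧small⇒≡0 z small h with abs z in eq | ℤ∣.∣⇒∣ᵤ h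
... | zero  | _ = ℤ.∣i∣≡0⇒i≡0 eq
... | suc n | k = contradiction small (≤⇒≯ (∣⇒≤ k))

*-cancel-≡0 : ∀ a b → a ≢ 0ℤ → a *ᶻ b ≡ 0ℤ → b ≡ 0ℤ
*-cancel-≡0 a b a≢0 h = [ ⊥-elim ∘ a≢0 , (λ e → e) ]′ (ℤ.i*j≡0⇒i≡0∨j≡0 a h)

-- Polynomials with small coefficients and a common root modulo p

module Polynomials (N : ℕ) (1≤N : 1 ≤ N) where

  private instance
    N≢0 : NonZero N
    N≢0 = >-nonZero 1≤N

  infix 4 _≼_·N^_
  -- This is z = O(N^e) with the explicit constant `k`. As a record it determines `k` and `e` by
  -- unification, so the constants of a compound expression are computed from those of its parts.
  record _≼_·N^_ (z : ℤ) (k e : ℕ) : Set where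
    constructor mk≼
    field bound : abs z ≤ k * N ^ e

  open _≼_·N^_

  ≼-* : ∀ {z w k l e f} → z ≼ k ·N^ e → w ≼ l ·N^ f → z *ᶻ w ≼ k * l ·N^ (e + f)
  ≼-* {z} {w} {k} {l} {e} {f} (mk≼ hz) (mk≼ hw) = mk≼ (begin
    abs (z *ᶻ w)              ≡⟨ ℤ.abs-* z w ⟩
    abs z * abs w             ≤⟨ *-mono-≤ hz hw ⟩
    k * N ^ e * (l * N ^ f)   ≡⟨ regroup k (N ^ e) l (N ^ f) ⟩
    k * l * (N ^ e * N ^ f)   ≡⟨ cong (k * l *_) (sym (^-distribˡ-+-* N e f)) ⟩
    k * l * N ^ (e + f)       ∎)
    where
    open ≤-Reasoning
    regroup : ∀ a b c d → a * b * (c * d) ≡ a * c * (b * d)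
    regroup = ℕ-ring

  ≼-minus : ∀ {z w k l e} → z ≼ k ·N^ e → w ≼ l ·N^ e → z -ᶻ w ≼ k + l ·N^ e
  ≼-minus {z} {w} {k} {l} {e} (mk≼ hz) (mk≼ hw) =
    mk≼ (≤-trans (ℤ.∣i-j∣≤∣i∣+∣j∣ z w) (≤-trans (+-mono-≤ hz hw) (≤-reflexive (sym (*-distribʳ-+ (N ^ e) k l)))))

  ≼-plus : ∀ {z w k l e} → z ≼ k ·N^ e → w ≼ l ·N^ e → z +ᶻ w ≼ k + l ·N^ e
  ≼-plus {z} {w} {k} {l} {e} (mk≼ hz) (mk≼ hw) =
    mk≼ (≤-trans (ℤ.∣i+j∣≤∣i∣+∣j∣ z w) (≤-trans (+-mono-≤ hz hw) (≤-reflexive (sym (*-distribʳ-+ (N ^ e) k l)))))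

  ≼-weaken : ∀ {z k l e f} → z ≼ k ·N^ e → {True (k ≤? l)} → {True (e ≤? f)} → z ≼ l ·N^ f
  ≼-weaken (mk≼ h) {k≤l} {e≤f} = mk≼ (≤-trans h (*-mono-≤ (toWitness k≤l) (^-monoʳ-≤ N (toWitness e≤f))))

  ≼-ℕ : ∀ {x} → x ≤ N → + x ≼ 1 ·N^ 1
  ≼-ℕ {x} h = mk≼ (≤-trans h (≤-reflexive (sym (trans (+-identityʳ _) (*-identityʳ N)))))

  value : ℤ → ℤ → ℤ → ℤ → ℤ
  value A B C x = A *ᶻ (x *ᶻ x) -ᶻ B *ᶻ x +ᶻ C

  -- A polynomial Q = A s² + B s + C such that each a s² + b s + c satisfying R is
  -- a constant multiple of Q, or vanishes at the root of Q if Q is linear; the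
  -- value A x² - B x + C is Q(-x).
  record CommonFactor (R : ℤ → ℤ → ℤ → Set) : Set where
    field
      A B C         : ℤ
      nonconstant   : ¬ (A ≡ 0ℤ × B ≡ 0ℤ)
      value≢0       : ∀ x → 1 ≤ x → x ≤ N → value A B C (+ x) ≢ 0ℤ
      value-bounded : ∀ x → x ≤ N → value A B C (+ x) ≼ 24 ·N^ 4
      multiples     : ∀ {a b c} → R a b c →
        (A ≢ 0ℤ × a *ᶻ B ≡ b *ᶻ A × a *ᶻ C ≡ c *ᶻ A) ⊎
        (A ≡ 0ℤ × a *ᶻ (C *ᶻ C) -ᶻ b *ᶻ (B *ᶻ C) +ᶻ c *ᶻ (B *ᶻ B) ≡ 0ℤ)

  module _ {p} (pp : Prime p) (1000N^8<p : 1000 * N ^ 8 < p) (L : ℤ)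
    (unit : ∀ x → 1 ≤ x → x ≤ N → ¬ (+ p ∣ᶻ L +ᶻ + x))
    (R : ℤ → ℤ → ℤ → Set)
    (bound-a : ∀ {a b c} → R a b c → a ≼ 3 ·N^ 1)
    (bound-b : ∀ {a b c} → R a b c → b ≼ 3 ·N^ 2)
    (bound-c : ∀ {a b c} → R a b c → c ≼ 1 ·N^ 3)
    (root    : ∀ {a b c} → R a b c → + p ∣ᶻ a *ᶻ (L *ᶻ L) +ᶻ b *ᶻ L +ᶻ c) where

    private
      -- The extreme uses are the resultant, at most 144 N⁸, and the determinants of two linear
      -- forms, at most 216 N⁷; 1000 N⁸ covers both. The degree 8 of the resultant is what ties the
      -- lengths to p^(1/8).
      small : ∀ {z k e} → z ≼ k ·N^ e → {True (k ≤? 1000)} → {True (e ≤? 8)} → + p ∣ᶻ z → z ≡ 0ℤ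
      small {z} h {k≤} {e≤} = ∣∧small⇒≡0 z (≤-<-trans (bound (≼-weaken h {k≤} {e≤})) 1000N^8<p)

      -- The case of a common rational root -γ / β: the expression in `vanish` is a s² + b s + c at
      -- that root, multiplied by β².
      module Linear (β γ : ℤ) (β≢0 : β ≢ 0ℤ) (hβ : β ≼ 18 ·N^ 3) (hγ : γ ≼ 6 ·N^ 4)
        (p∣βL+γ : + p ∣ᶻ β *ᶻ L +ᶻ γ)
        (vanish : ∀ {a b c} → R a b c → a *ᶻ (γ *ᶻ γ) -ᶻ b *ᶻ (β *ᶻ γ) +ᶻ c *ᶻ (β *ᶻ β) ≡ 0ℤ) where

        value-≡ : ∀ β γ x → 0ℤ *ᶻ (x *ᶻ x) -ᶻ (-ᶻ β) *ᶻ x +ᶻ (-ᶻ γ) ≡ β *ᶻ x -ᶻ γ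
        value-≡ = ℤ-ring

        shift : ∀ β γ L x → β *ᶻ L +ᶻ γ +ᶻ (β *ᶻ x -ᶻ γ) ≡ β *ᶻ (L +ᶻ x)
        shift = ℤ-ring

        negate : ∀ a b c β γ → a *ᶻ (-ᶻ γ *ᶻ -ᶻ γ) -ᶻ b *ᶻ (-ᶻ β *ᶻ -ᶻ γ) +ᶻ c *ᶻ (-ᶻ β *ᶻ -ᶻ β)
                 ≡ a *ᶻ (γ *ᶻ γ) -ᶻ b *ᶻ (β *ᶻ γ) +ᶻ c *ᶻ (β *ᶻ β)
        negate = ℤ-ring

        -- If β x = γ, then β L + γ = β (L + x), and p would divide either β, which is too small, or
        -- the unit L + x.
        βx-γ≢0 : ∀ x → 1 ≤ x → x ≤ N → β *ᶻ + x -ᶻ γ ≢ 0ℤ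
        βx-γ≢0 x 1≤x x≤N eq = [ β≢0 ∘ small hβ , unit x 1≤x x≤N ]′
          (euclid pp β (L +ᶻ + x) (subst (+ p ∣ᶻ_)
            (trans (sym (ℤ.+-identityʳ _)) (trans (cong (β *ᶻ L +ᶻ γ +ᶻ_) (sym eq)) (shift β γ L (+ x)))) p∣βL+γ))

        factor : CommonFactor R
        factor = record
          -- With these signs Q(-x) is `β x - γ`.
          { A = 0ℤ ; B = -ᶻ β ; C = -ᶻ γ
          ; nonconstant = λ (_ , eq) → β≢0 (trans (sym (ℤ.neg-involutive β)) (cong -ᶻ_ eq))
          ; value≢0 = λ x 1≤x x≤N eq → βx-γ≢0 x 1≤x x≤N (trans (sym (value-≡ β γ (+ x))) eq)
          -- Here 18 N³ · N + 6 N⁴ produces the constant in 24 N⁴.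
          ; value-bounded = λ x x≤N → subst (_≼ 24 ·N^ 4) (sym (value-≡ β γ (+ x)))
              (≼-minus (≼-* hβ (≼-ℕ x≤N)) hγ)
          ; multiples = λ {a} {b} {c} r → inj₂ (refl , trans (negate a b c β γ) (vanish r))
          }

      -- P₀ = a₀ s² + b₀ s + c₀ is a fixed member of `R` of degree 2 against which all others are
      -- compared.
      module WithQuadratic (¬factor : ¬ CommonFactor R)
        {a₀ b₀ c₀ : ℤ} (r₀ : R a₀ b₀ c₀) (a₀≢0 : a₀ ≢ 0ℤ) where

        -- β′ s + γ′ is a P₀ - a₀ P, in which the quadratic terms cancel.
        β′ γ′ : ℤ → ℤ → ℤ
        β′ a b = a *ᶻ b₀ -ᶻ a₀ *ᶻ b
        γ′ a c = a *ᶻ c₀ -ᶻ a₀ *ᶻ c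

        β′-bound : ∀ {a b c} → R a b c → β′ a b ≼ 18 ·N^ 3
        β′-bound {a} {b} {c} r = ≼-minus
          (≼-* (bound-a r) (bound-b r₀))
          (≼-* (bound-a r₀) (bound-b r))

        γ′-bound : ∀ {a b c} → R a b c → γ′ a c ≼ 6 ·N^ 4
        γ′-bound {a} {b} {c} r = ≼-minus
          (≼-* (bound-a r) (bound-c r₀))
          (≼-* (bound-a r₀) (bound-c r))

        eliminate : ∀ a b c a₀ b₀ c₀ L →
          a *ᶻ (a₀ *ᶻ (L *ᶻ L) +ᶻ b₀ *ᶻ L +ᶻ c₀) -ᶻ a₀ *ᶻ (a *ᶻ (L *ᶻ L) +ᶻ b *ᶻ L +ᶻ c) ≡
          (a *ᶻ b₀ -ᶻ a₀ *ᶻ b) *ᶻ L +ᶻ (a *ᶻ c₀ -ᶻ a₀ *ᶻ c)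
        eliminate = ℤ-ring

        p∣β′L+γ′ : ∀ {a b c} → R a b c → + p ∣ᶻ β′ a b *ᶻ L +ᶻ γ′ a c
        p∣β′L+γ′ {a} {b} {c} r = subst (+ p ∣ᶻ_) (eliminate a b c a₀ b₀ c₀ L)
          (ℤ∣.∣m∣n⇒∣m-n (ℤ∣.∣n⇒∣m*n a (root r₀)) (ℤ∣.∣n⇒∣m*n a₀ (root r)))

        -- With β ≠ 0 the polynomials P₀ and P₁ are not proportional. Their resultant is zero, which
        -- makes -γ / β a root of P₀, and then every member of `R` vanishes there, so `Linear`
        -- applies.
        module Independent {a₁ b₁ c₁ : ℤ} (r₁ : R a₁ b₁ c₁) (β≢0 : β′ a₁ b₁ ≢ 0ℤ) where
          β = β′ a₁ b₁
          γ = γ′ a₁ c₁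

          -- P₀ and P₁ have the common root L modulo p, so p divides their resultant.
          resultant = γ *ᶻ γ -ᶻ β *ᶻ (b₁ *ᶻ c₀ -ᶻ b₀ *ᶻ c₁)

          -- The left side is β² P₀(-γ / β).
          a₀*resultant : ∀ a₀ b₀ c₀ a₁ b₁ c₁ →
            let β = a₁ *ᶻ b₀ -ᶻ a₀ *ᶻ b₁ ; γ = a₁ *ᶻ c₀ -ᶻ a₀ *ᶻ c₁ in
            a₀ *ᶻ (γ *ᶻ γ) -ᶻ b₀ *ᶻ (β *ᶻ γ) +ᶻ c₀ *ᶻ (β *ᶻ β) ≡
            a₀ *ᶻ (γ *ᶻ γ -ᶻ β *ᶻ (b₁ *ᶻ c₀ -ᶻ b₀ *ᶻ c₁))
          a₀*resultant = ℤ-ring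

          -- Division of β² (a s² + b s + c) by β s + γ, at s = L; the right side is the remainder.
          homogenise : ∀ a b c β γ L →
            β *ᶻ β *ᶻ (a *ᶻ (L *ᶻ L) +ᶻ b *ᶻ L +ᶻ c) -ᶻ
              (a *ᶻ (β *ᶻ L -ᶻ γ) +ᶻ b *ᶻ β) *ᶻ (β *ᶻ L +ᶻ γ) ≡
            a *ᶻ (γ *ᶻ γ) -ᶻ b *ᶻ (β *ᶻ γ) +ᶻ c *ᶻ (β *ᶻ β)
          homogenise = ℤ-ring

          resultant-bound : resultant ≼ 144 ·N^ 8
          resultant-bound = ≼-minus
            (≼-* (γ′-bound r₁) (γ′-bound r₁))
            (≼-* (β′-bound r₁)
              (≼-minus
                (≼-* (bound-b r₁) (bound-c r₀))
                (≼-* (bound-b r₀) (bound-c r₁))))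

          p∣a₀*resultant : + p ∣ᶻ a₀ *ᶻ resultant
          p∣a₀*resultant = subst (+ p ∣ᶻ_)
            (trans (homogenise a₀ b₀ c₀ β γ L) (a₀*resultant a₀ b₀ c₀ a₁ b₁ c₁))
            (ℤ∣.∣m∣n⇒∣m-n (ℤ∣.∣n⇒∣m*n (β *ᶻ β) (root r₀))
              (ℤ∣.∣n⇒∣m*n (a₀ *ᶻ (β *ᶻ L -ᶻ γ) +ᶻ b₀ *ᶻ β) (p∣β′L+γ′ r₁)))

          resultant≡0 : resultant ≡ 0ℤ
          resultant≡0 = [ ⊥-elim ∘ a₀≢0 ∘ small (bound-a r₀) , small resultant-bound ]′
            (euclid pp a₀ resultant p∣a₀*resultant)

          P₀-vanishes : a₀ *ᶻ (γ *ᶻ γ) -ᶻ b₀ *ᶻ (β *ᶻ γ) +ᶻ c₀ *ᶻ (β *ᶻ β) ≡ 0ℤ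
          P₀-vanishes = trans (a₀*resultant a₀ b₀ c₀ a₁ b₁ c₁)
            (trans (cong (a₀ *ᶻ_) resultant≡0) (ℤ.*-zeroʳ a₀))

          cross : ∀ β γ δ η L → δ *ᶻ (β *ᶻ L +ᶻ γ) -ᶻ β *ᶻ (δ *ᶻ L +ᶻ η) ≡ δ *ᶻ γ -ᶻ η *ᶻ β
          cross = ℤ-ring

          -- The linear forms β′ s + γ′ and β s + γ both vanish at L modulo p, so p divides their
          -- determinant, which is small.
          proportional : ∀ {a b c} → R a b c → β′ a b *ᶻ γ -ᶻ γ′ a c *ᶻ β ≡ 0ℤ
          proportional {a} {b} {c} r = small
            (≼-minus
              (≼-* (β′-bound r) (γ′-bound r₁))
              (≼-* (γ′-bound r) (β′-bound r₁)))
            (subst (+ p ∣ᶻ_) (cross β γ (β′ a b) (γ′ a c) L)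
              (ℤ∣.∣m∣n⇒∣m-n (ℤ∣.∣n⇒∣m*n (β′ a b) (p∣β′L+γ′ r₁)) (ℤ∣.∣n⇒∣m*n β (p∣β′L+γ′ r))))

          -- The relation a₀ P = a P₀ - (β′ s + γ′) at s = -γ / β, multiplied by β².
          reduce : ∀ a b c a₀ b₀ c₀ β γ →
            a₀ *ᶻ (a *ᶻ (γ *ᶻ γ) -ᶻ b *ᶻ (β *ᶻ γ) +ᶻ c *ᶻ (β *ᶻ β)) ≡
            a *ᶻ (a₀ *ᶻ (γ *ᶻ γ) -ᶻ b₀ *ᶻ (β *ᶻ γ) +ᶻ c₀ *ᶻ (β *ᶻ β)) +ᶻ
            β *ᶻ ((a *ᶻ b₀ -ᶻ a₀ *ᶻ b) *ᶻ γ -ᶻ (a *ᶻ c₀ -ᶻ a₀ *ᶻ c) *ᶻ β)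
          reduce = ℤ-ring

          vanish : ∀ {a b c} → R a b c → a *ᶻ (γ *ᶻ γ) -ᶻ b *ᶻ (β *ᶻ γ) +ᶻ c *ᶻ (β *ᶻ β) ≡ 0ℤ
          vanish {a} {b} {c} r = *-cancel-≡0 a₀ _ a₀≢0
            (trans (reduce a b c a₀ b₀ c₀ β γ)
              (trans (cong₂ (λ s t → a *ᶻ s +ᶻ β *ᶻ t) P₀-vanishes (proportional r))
                (cong₂ _+ᶻ_ (ℤ.*-zeroʳ a) (ℤ.*-zeroʳ β))))

          absurd : ⊥
          absurd = ¬factor (Linear.factor β γ β≢0 (β′-bound r₁) (γ′-bound r₁) (p∣β′L+γ′ r₁) vanish)

        -- Since no member is independent of P₀, the linear form β′ s + γ′ reduces to the constant
        -- γ′, which p divides and which is therefore zero as well: every member is a rational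
        -- multiple of P₀.
        β′≡0 : ∀ {a b c} → R a b c → β′ a b ≡ 0ℤ
        β′≡0 {a} {b} r = decidable-stable (β′ a b ℤ.≟ 0ℤ) (Independent.absurd r)

        γ′≡0 : ∀ {a b c} → R a b c → γ′ a c ≡ 0ℤ
        γ′≡0 {a} {b} {c} r = small (γ′-bound r) (subst (+ p ∣ᶻ_)
          (trans (cong (λ z → z *ᶻ L +ᶻ γ′ a c) (β′≡0 r)) (ℤ.+-identityˡ _)) (p∣β′L+γ′ r))

        -- P₀ cannot serve as Q if it vanishes at some -x. In that case P₀ = (s + x) (a₀ s + γ), and
        -- since L + x is a unit, it is a₀ s + γ that vanishes at L modulo p; this linear factor
        -- replaces P₀.
        module RationalRoot (x : ℕ) (1≤x : 1 ≤ x) (x≤N : x ≤ N) (P₀[-x]≡0 : value a₀ b₀ c₀ (+ x) ≡ 0ℤ) where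
          γ = b₀ -ᶻ a₀ *ᶻ + x

          factor-at-root : ∀ a b c L x → a *ᶻ (L *ᶻ L) +ᶻ b *ᶻ L +ᶻ c -ᶻ (a *ᶻ (x *ᶻ x) -ᶻ b *ᶻ x +ᶻ c) ≡
            (L +ᶻ x) *ᶻ (a *ᶻ L +ᶻ (b -ᶻ a *ᶻ x))
          factor-at-root = ℤ-ring

          p∣a₀L+γ : + p ∣ᶻ a₀ *ᶻ L +ᶻ γ
          p∣a₀L+γ = [ ⊥-elim ∘ unit x 1≤x x≤N , (λ h → h) ]′ (euclid pp (L +ᶻ + x) (a₀ *ᶻ L +ᶻ γ) (subst (+ p ∣ᶻ_)
            (trans (trans (sym (ℤ.+-identityʳ _)) (cong (λ z → a₀ *ᶻ (L *ᶻ L) +ᶻ b₀ *ᶻ L +ᶻ c₀ -ᶻ z) (sym P₀[-x]≡0)))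
              (factor-at-root a₀ b₀ c₀ L (+ x))) (root r₀)))

          γ-bound : γ ≼ 6 ·N^ 2
          γ-bound = ≼-minus (bound-b r₀)
            (≼-* (bound-a r₀) (≼-ℕ x≤N))

          reduce : ∀ a b c a₀ b₀ c₀ x → let γ = b₀ -ᶻ a₀ *ᶻ x in
            a₀ *ᶻ (a *ᶻ (γ *ᶻ γ) -ᶻ b *ᶻ (a₀ *ᶻ γ) +ᶻ c *ᶻ (a₀ *ᶻ a₀)) ≡
            a *ᶻ (a₀ *ᶻ (a₀ *ᶻ (a₀ *ᶻ (x *ᶻ x) -ᶻ b₀ *ᶻ x +ᶻ c₀))) +ᶻ
            a₀ *ᶻ ((a *ᶻ b₀ -ᶻ a₀ *ᶻ b) *ᶻ γ -ᶻ (a *ᶻ c₀ -ᶻ a₀ *ᶻ c) *ᶻ a₀)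
          reduce = ℤ-ring

          zeroes : ∀ a a₀ γ → a *ᶻ (a₀ *ᶻ (a₀ *ᶻ 0ℤ)) +ᶻ a₀ *ᶻ (0ℤ *ᶻ γ -ᶻ 0ℤ *ᶻ a₀) ≡ 0ℤ
          zeroes = ℤ-ring

          vanish : ∀ {a b c} → R a b c → a *ᶻ (γ *ᶻ γ) -ᶻ b *ᶻ (a₀ *ᶻ γ) +ᶻ c *ᶻ (a₀ *ᶻ a₀) ≡ 0ℤ
          vanish {a} {b} {c} r = *-cancel-≡0 a₀ _ a₀≢0
            (trans (reduce a b c a₀ b₀ c₀ (+ x))
              (trans (cong₂ (λ s t → a *ᶻ (a₀ *ᶻ (a₀ *ᶻ s)) +ᶻ a₀ *ᶻ t) P₀[-x]≡0
                (cong₂ (λ s t → s *ᶻ γ -ᶻ t *ᶻ a₀) (β′≡0 r) (γ′≡0 r))) (zeroes a a₀ γ)))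

          absurd : ⊥
          absurd = ¬factor (Linear.factor a₀ γ a₀≢0 (≼-weaken (bound-a r₀))
            (≼-weaken γ-bound) p∣a₀L+γ vanish)

        value-bounded : ∀ x → x ≤ N → value a₀ b₀ c₀ (+ x) ≼ 24 ·N^ 4
        value-bounded x x≤N = ≼-weaken
          (≼-plus
            (≼-minus
              (≼-* (bound-a r₀)
                (≼-* (≼-ℕ x≤N) (≼-ℕ x≤N)))
              (≼-* (bound-b r₀) (≼-ℕ x≤N)))
            (bound-c r₀))

        absurd : ⊥
        absurd = ¬factor record
          { A = a₀ ; B = b₀ ; C = c₀
          ; nonconstant = λ (eq , _) → a₀≢0 eq
          ; value≢0 = RationalRoot.absurd
          ; value-bounded = value-bounded
          ; multiples = λ {a} {b} {c} r → inj₁ (a₀≢0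
              , trans (ℤ.i-j≡0⇒i≡j _ _ (β′≡0 r)) (ℤ.*-comm a₀ b)
              , trans (ℤ.i-j≡0⇒i≡j _ _ (γ′≡0 r)) (ℤ.*-comm a₀ c))
          }

      module AllLinear (¬factor : ¬ CommonFactor R) (a≡0 : ∀ {a b c} → R a b c → a ≡ 0ℤ) where

        drop-square : ∀ b c L → 0ℤ *ᶻ (L *ᶻ L) +ᶻ b *ᶻ L +ᶻ c ≡ b *ᶻ L +ᶻ c
        drop-square = ℤ-ring

        p∣bL+c : ∀ {a b c} → R a b c → + p ∣ᶻ b *ᶻ L +ᶻ c
        p∣bL+c {a} {b} {c} r = subst (+ p ∣ᶻ_)
          (trans (cong (λ z → z *ᶻ (L *ᶻ L) +ᶻ b *ᶻ L +ᶻ c) (a≡0 r)) (drop-square b c L)) (root r)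

        module _ {a₀ b₀ c₀ : ℤ} (r₀ : R a₀ b₀ c₀) (b₀≢0 : b₀ ≢ 0ℤ) where

          cross : ∀ b c b₀ c₀ L → b *ᶻ (b₀ *ᶻ L +ᶻ c₀) -ᶻ b₀ *ᶻ (b *ᶻ L +ᶻ c) ≡ b *ᶻ c₀ -ᶻ b₀ *ᶻ c
          cross = ℤ-ring

          proportional : ∀ {a b c} → R a b c → b *ᶻ c₀ -ᶻ b₀ *ᶻ c ≡ 0ℤ
          proportional {a} {b} {c} r = small
            (≼-minus
              (≼-* (bound-b r) (bound-c r₀))
              (≼-* (bound-b r₀) (bound-c r)))
            (subst (+ p ∣ᶻ_) (cross b c b₀ c₀ L)
              (ℤ∣.∣m∣n⇒∣m-n (ℤ∣.∣n⇒∣m*n b (p∣bL+c r₀)) (ℤ∣.∣n⇒∣m*n b₀ (p∣bL+c r))))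

          regroup : ∀ b c b₀ c₀ → 0ℤ *ᶻ (c₀ *ᶻ c₀) -ᶻ b *ᶻ (b₀ *ᶻ c₀) +ᶻ c *ᶻ (b₀ *ᶻ b₀) ≡
            -ᶻ b₀ *ᶻ (b *ᶻ c₀ -ᶻ b₀ *ᶻ c)
          regroup = ℤ-ring

          vanish : ∀ {a b c} → R a b c → a *ᶻ (c₀ *ᶻ c₀) -ᶻ b *ᶻ (b₀ *ᶻ c₀) +ᶻ c *ᶻ (b₀ *ᶻ b₀) ≡ 0ℤ
          vanish {a} {b} {c} r = trans (cong (λ z → z *ᶻ (c₀ *ᶻ c₀) -ᶻ b *ᶻ (b₀ *ᶻ c₀) +ᶻ c *ᶻ (b₀ *ᶻ b₀)) (a≡0 r))
            (trans (regroup b c b₀ c₀) (trans (cong (-ᶻ b₀ *ᶻ_) (proportional r)) (ℤ.*-zeroʳ (-ᶻ b₀))))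

          absurd₁ : ⊥
          absurd₁ = ¬factor (Linear.factor b₀ c₀ b₀≢0 (≼-weaken (bound-b r₀))
            (≼-weaken (bound-c r₀)) (p∣bL+c r₀) vanish)

        b≡0 : ∀ {a b c} → R a b c → b ≡ 0ℤ
        b≡0 {a} {b} r = decidable-stable (b ℤ.≟ 0ℤ) (absurd₁ r)

        c≡0 : ∀ {a b c} → R a b c → c ≡ 0ℤ
        c≡0 {a} {b} {c} r = small (bound-c r) (subst (+ p ∣ᶻ_)
          (trans (cong (λ z → z *ᶻ L +ᶻ c) (b≡0 r)) (ℤ.+-identityˡ _)) (p∣bL+c r))

        value-≡ : ∀ x → 0ℤ *ᶻ (x *ᶻ x) -ᶻ (-ᶻ 1ℤ) *ᶻ x +ᶻ 0ℤ ≡ x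
        value-≡ = ℤ-ring

        absurd : ⊥
        absurd = ¬factor record
          -- Only the zero polynomial is left in `R`, and the choice Q(s) = -s has the nonzero
          -- values Q(-x) = x.
          { A = 0ℤ ; B = -ᶻ 1ℤ ; C = 0ℤ
          ; nonconstant = λ ()
          ; value≢0 = λ x 1≤x _ eq → contradiction (ℤ.+-injective (trans (sym (value-≡ (+ x))) eq)) (>⇒≢ 1≤x)
          ; value-bounded = λ x x≤N → subst (_≼ 24 ·N^ 4) (sym (value-≡ (+ x)))
              (≼-weaken (≼-ℕ x≤N))
          ; multiples = λ r → inj₂ (refl , zeroes (a≡0 r) (b≡0 r) (c≡0 r))
          }
          where
          zeroes : ∀ {a b c} → a ≡ 0ℤ → b ≡ 0ℤ → c ≡ 0ℤ →
            a *ᶻ (0ℤ *ᶻ 0ℤ) -ᶻ b *ᶻ (-ᶻ 1ℤ *ᶻ 0ℤ) +ᶻ c *ᶻ (-ᶻ 1ℤ *ᶻ -ᶻ 1ℤ) ≡ 0ℤ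
          zeroes refl refl refl = refl

    -- The case distinction asks whether `R` has a member with a ≠ 0, or one independent of P₀,
    -- which is undecided for an arbitrary predicate. Hence the double negation; it disappears once
    -- a decidable inequality is derived from the factor.
    commonFactor : ¬ ¬ CommonFactor R
    commonFactor ¬factor = AllLinear.absurd ¬factor λ {a} r →
      decidable-stable (a ℤ.≟ 0ℤ) (WithQuadratic.absurd ¬factor r)

-- Counting the solutions for a single interval

∑𝟙≤1 : {P : S → Set} (P? : ∀ x → Dec (P x)) {xs : List S} → Unique xs →
  (∀ {x y} → P x → P y → x ≡ y) → ∑ xs (λ x → 𝟙 (P? x)) ≤ 1
∑𝟙≤1 P? [] h = z≤n
∑𝟙≤1 P? {x ∷ xs} (x∉ ∷ u) h with P? x
... | no _  = ∑𝟙≤1 P? u h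
... | yes p = s≤s (≤-reflexive (∑-all-zero xs λ {y} y∈ → 𝟙-no (P? y) λ q → All.lookup x∉ y∈ (h p q)))

∑𝟙≤2 : {P : S → Set} (P? : ∀ x → Dec (P x)) {xs : List S} → Unique xs →
  (∀ {x y z} → P x → P y → P z → x ≢ y → x ≢ z → y ≡ z) → ∑ xs (λ x → 𝟙 (P? x)) ≤ 2
∑𝟙≤2 P? [] h = z≤n
∑𝟙≤2 {S = S} {P = P} P? {x ∷ xs} (x∉ ∷ u) h with P? x
... | no _  = ∑𝟙≤2 P? u h
... | yes p = s≤s (others x∉ u)
  where
  others : ∀ {ys} → All (x ≢_) ys → Unique ys → ∑ ys (λ y → 𝟙 (P? y)) ≤ 1
  others [] [] = z≤n
  others {y ∷ ys} (x≢y ∷ x∉) (y∉ ∷ u) with P? y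
  ... | no _  = others x∉ u
  ... | yes q = s≤s (≤-reflexive (∑-all-zero ys λ {z} z∈ → 𝟙-no (P? z) λ r →
    All.lookup y∉ z∈ (h p q r x≢y (All.lookup x∉ z∈))))

-- The `x` are sorted by the divisor d = h x of `n`: at most `T` values of d, each attained at most
-- `k` times.
∑-divides : (h : S → ℕ) (xs : List S) (k : ℕ) → (∀ d → ∑ xs (λ x → 𝟙 (h x ℕ.≟ d)) ≤ k) →
  ∀ {n T} → 1 ≤ n → DivisorBound n T → ∑ xs (λ x → 𝟙 (h x ∣? n)) ≤ T * k
∑-divides h xs k fibre {n@(suc _)} {T} _ bound = begin
  ∑ xs (λ x → 𝟙 (h x ∣? n))
    ≤⟨ ∑-mono xs (λ x → 𝟙-≤ (h x ∣? n) λ hx∣n → ≤-trans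
         (≤-reflexive (sym (𝟙-yes (h x ℕ.≟ h x) refl)))
         (∑-≥ (λ d → 𝟙 (h x ℕ.≟ d)) (∈-filter⁺ (_∣? n) (∈-upTo⁺ (s≤s (∣⇒≤ hx∣n))) hx∣n))) ⟩
  ∑ xs (λ x → ∑ ds λ d → 𝟙 (h x ℕ.≟ d))        ≡⟨ ∑-swap xs ds (λ x d → 𝟙 (h x ℕ.≟ d)) ⟩
  ∑ ds (λ d → ∑ xs λ x → 𝟙 (h x ℕ.≟ d))        ≤⟨ ∑-≤ ds k (λ {d} _ → fibre d) ⟩
  length ds * k
    ≤⟨ *-monoˡ-≤ k (bound (Unique.filter⁺ (_∣? n) (Unique.upTo⁺ (suc n))) (All.all-filter (_∣? n) (upTo (suc n)))) ⟩
  T * k                                        ∎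
  where
  open ≤-Reasoning
  ds = filter (_∣? n) (upTo (suc n))

-- The maximum of `f` serves as `M`; it stands in for the m-th root of `W`, which need not be an
-- integer.
uniform-bound : (xs : List S) (f : S → ℕ) (m W : ℕ) .{{_ : NonZero m}} → (∀ {x} → x ∈ xs → f x ^ m ≤ W) →
  ∃[ M ] M ^ m ≤ W × (∀ {x} → x ∈ xs → f x ≤ M)
uniform-bound [] f (suc _) W h = 0 , z≤n , λ ()
uniform-bound (x ∷ xs) f m W h with M , M^m≤W , f≤M ← uniform-bound xs f m W (h ∘ there) with ≤-total (f x) M
... | inj₁ fx≤M = M , M^m≤W , λ { (here refl) → fx≤M ; (there x∈) → f≤M x∈ }
... | inj₂ M≤fx = f x , h (here refl) , λ { (here refl) → ≤-refl ; (there x∈) → ≤-trans (f≤M x∈) M≤fx }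

∑-^-≤ : (xs : List S) (f : S → ℕ) (m W : ℕ) .{{_ : NonZero m}} → (∀ {x} → x ∈ xs → f x ^ m ≤ W) →
  ∑ xs f ^ m ≤ length xs ^ m * W
∑-^-≤ xs f m W h with M , M^m≤W , f≤M ← uniform-bound xs f m W h = begin
  ∑ xs f ^ m            ≤⟨ ^-monoˡ-≤ m (∑-≤ xs M f≤M) ⟩
  (length xs * M) ^ m   ≡⟨ ^-distribʳ-* (length xs) M m ⟩
  length xs ^ m * M ^ m ≤⟨ *-monoʳ-≤ (length xs ^ m) M^m≤W ⟩
  length xs ^ m * W     ∎
  where open ≤-Reasoning

abs-difference-≤ : ∀ {m n k} → m ≤ k → n ≤ k → abs (+ m -ᶻ + n) ≤ k
abs-difference-≤ {m} {n} m≤k n≤k =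
  ≤-trans (≤-reflexive (cong abs (ℤ.m-n≡m⊖n m n))) (≤-trans (ℤ.∣m⊝n∣≤m⊔n m n) (⊔-lub m≤k n≤k))

length-cartesianProduct : (xs : List S) (ys : List T) → length (cartesianProduct xs ys) ≡ length xs * length ys
length-cartesianProduct []       ys = refl
length-cartesianProduct (x ∷ xs) ys = trans (length-++ (map (x ,_) ys))
  (cong₂ _+_ (length-map (x ,_) ys) (length-cartesianProduct xs ys))

-- The 64 belongs to the bound 64 T² for the triples of a given norm. The squared factor is the
-- constant in T^m ≤ `divisorConstant m` · (24 N⁴)³.
energyConstant : ℕ → ℕ
energyConstant m = 64 ^ m * (divisorConstant m * 24 ^ 3 * (divisorConstant m * 24 ^ 3))

∏³ : {S : Set} (_·_ : S → S → S) → (ℕ → S) → ℕ × ℕ × ℕ → S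
∏³ _·_ f (x , y , z) = (f x · f y) · f z

e₁ e₂ e₃ : ℕ × ℕ × ℕ → ℕ
e₁ (x , y , z) = x + y + z
e₂ (x , y , z) = x * y + y * z + z * x
e₃ (x , y , z) = x * y * z

pos-e₂ : ∀ x y z → + e₂ (x , y , z) ≡ + x *ᶻ + y +ᶻ + y *ᶻ + z +ᶻ + z *ᶻ + x
pos-e₂ x y z = cong₂ _+ᶻ_ (cong₂ _+ᶻ_ (ℤ.pos-* x y) (ℤ.pos-* y z)) (ℤ.pos-* z x)

pos-e₃ : ∀ x y z → + e₃ (x , y , z) ≡ + x *ᶻ + y *ᶻ + z
pos-e₃ x y z = trans (ℤ.pos-* (x * y) z) (cong (_*ᶻ + z) (ℤ.pos-* x y))

module _ (N : ℕ) (1≤N : 1 ≤ N) where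
  open Polynomials N 1≤N

  interval : List ℕ
  interval = applyUpTo suc N

  interval-unique : Unique interval
  interval-unique = Unique.applyUpTo⁺₁ suc N λ i<j _ eq → <⇒≢ i<j (suc-injective eq)

  ∈-interval : ∀ {x} → x ∈ interval → 1 ≤ x × x ≤ N
  ∈-interval x∈ with _ , i<N , refl ← ∈-applyUpTo⁻ suc x∈ = s≤s z≤n , i<N

  triples : List (ℕ × ℕ × ℕ)
  triples = cartesianProduct interval (cartesianProduct interval interval)

  InBox : ℕ × ℕ × ℕ → Set
  InBox (x , y , z) = (1 ≤ x × x ≤ N) × (1 ≤ y × y ≤ N) × (1 ≤ z × z ≤ N)

  ∈-triples : ∀ {t} → t ∈ triples → InBox t
  ∈-triples t∈ with x∈ , yz∈ ← ∈-cartesianProduct⁻ interval (cartesianProduct interval interval) t∈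
               with y∈ , z∈ ← ∈-cartesianProduct⁻ interval interval yz∈ =
    ∈-interval x∈ , ∈-interval y∈ , ∈-interval z∈

  e₁≤ : ∀ t → InBox t → e₁ t ≤ 3 * N ^ 1
  e₁≤ (x , y , z) ((_ , hx) , (_ , hy) , (_ , hz)) =
    ≤-trans (+-mono-≤ (+-mono-≤ hx hy) hz) (≤-reflexive (three N))
    where
    three : ∀ N → N + N + N ≡ 3 * (N * 1)
    three = ℕ-ring

  e₂≤ : ∀ t → InBox t → e₂ t ≤ 3 * N ^ 2
  e₂≤ (x , y , z) ((_ , hx) , (_ , hy) , (_ , hz)) =
    ≤-trans (+-mono-≤ (+-mono-≤ (*-mono-≤ hx hy) (*-mono-≤ hy hz)) (*-mono-≤ hz hx)) (≤-reflexive (three N))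
    where
    three : ∀ N → N * N + N * N + N * N ≡ 3 * (N * (N * 1))
    three = ℕ-ring

  e₃≤ : ∀ t → InBox t → e₃ t ≤ 1 * N ^ 3
  e₃≤ (x , y , z) ((_ , hx) , (_ , hy) , (_ , hz)) =
    ≤-trans (*-mono-≤ (*-mono-≤ hx hy) hz) (≤-reflexive (one N))
    where
    one : ∀ N → N * N * N ≡ 1 * (N * (N * (N * 1)))
    one = ℕ-ring

  productOfValues : ℤ → ℤ → ℤ → ℕ × ℕ × ℕ → ℤ
  productOfValues A B C = ∏³ _*ᶻ_ (λ x → value A B C (+ x))

  -- A² Q(-x₁) Q(-x₂) Q(-x₃) is the norm form A v² - B u v + C u² of the remainder u s + v
  -- of A² (s + x₁) (s + x₂) (s + x₃) modulo Q = A s² + B s + C.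
  normForm : ℤ → ℤ → ℤ → ℤ → ℤ → ℤ
  normForm A B C s t = u *ᶻ u *ᶻ C -ᶻ u *ᶻ v *ᶻ B +ᶻ A *ᶻ (v *ᶻ v)
    where
    u = A *ᶻ s +ᶻ (B *ᶻ B -ᶻ A *ᶻ C)
    v = A *ᶻ t +ᶻ B *ᶻ C

  productOfValues-normForm : ∀ A B C x → A *ᶻ (A *ᶻ productOfValues A B C x) ≡
    normForm A B C (A *ᶻ + e₂ x -ᶻ + e₁ x *ᶻ B) (A *ᶻ + e₃ x -ᶻ + e₁ x *ᶻ C)
  productOfValues-normForm A B C (x , y , z) = trans (expand A B C (+ x) (+ y) (+ z))
    (cong₂ (λ s t → normForm A B C (A *ᶻ s -ᶻ (+ x +ᶻ + y +ᶻ + z) *ᶻ B) (A *ᶻ t -ᶻ (+ x +ᶻ + y +ᶻ + z) *ᶻ C))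
      (sym (pos-e₂ x y z)) (sym (pos-e₃ x y z)))
    where
    expand : ∀ A B C x y z →
      A *ᶻ (A *ᶻ ((A *ᶻ (x *ᶻ x) -ᶻ B *ᶻ x +ᶻ C) *ᶻ (A *ᶻ (y *ᶻ y) -ᶻ B *ᶻ y +ᶻ C) *ᶻ (A *ᶻ (z *ᶻ z) -ᶻ B *ᶻ z +ᶻ C))) ≡
      (let u = A *ᶻ (A *ᶻ (x *ᶻ y +ᶻ y *ᶻ z +ᶻ z *ᶻ x) -ᶻ (x +ᶻ y +ᶻ z) *ᶻ B) +ᶻ (B *ᶻ B -ᶻ A *ᶻ C)
           v = A *ᶻ (A *ᶻ (x *ᶻ y *ᶻ z) -ᶻ (x +ᶻ y +ᶻ z) *ᶻ C) +ᶻ B *ᶻ C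
       in u *ᶻ u *ᶻ C -ᶻ u *ᶻ v *ᶻ B +ᶻ A *ᶻ (v *ᶻ v))
    expand = ℤ-ring

  private
    proportional⇒≡ : ∀ A B s s′ t t′ → (s -ᶻ s′) *ᶻ B ≡ (t -ᶻ t′) *ᶻ A → A *ᶻ t -ᶻ s *ᶻ B ≡ A *ᶻ t′ -ᶻ s′ *ᶻ B
    proportional⇒≡ A B s s′ t t′ eq =
      ℤ.i-j≡0⇒i≡j _ _ (trans (regroup A B s s′ t t′) (ℤ.i≡j⇒i-j≡0 (sym eq)))
      where
      regroup : ∀ A B s s′ t t′ → A *ᶻ t -ᶻ s *ᶻ B -ᶻ (A *ᶻ t′ -ᶻ s′ *ᶻ B) ≡ (t -ᶻ t′) *ᶻ A -ᶻ (s -ᶻ s′) *ᶻ B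
      regroup = ℤ-ring

  -- The difference of the two cubics is a multiple of Q, so both leave the same remainder modulo Q
  -- and the norm form takes the same value. The factor A² of the norm form identity is cancelled.
  productOfValues-quadratic : ∀ A B C x y → A ≢ 0ℤ →
    (+ e₁ x -ᶻ + e₁ y) *ᶻ B ≡ (+ e₂ x -ᶻ + e₂ y) *ᶻ A →
    (+ e₁ x -ᶻ + e₁ y) *ᶻ C ≡ (+ e₃ x -ᶻ + e₃ y) *ᶻ A →
    productOfValues A B C x ≡ productOfValues A B C y
  productOfValues-quadratic A B C x y A≢0 aB≡bA aC≡cA =
    ℤ.*-cancelˡ-≡ A _ _ {{ℤ.≢-nonZero A≢0}} (ℤ.*-cancelˡ-≡ A _ _ {{ℤ.≢-nonZero A≢0}}
      (trans (productOfValues-normForm A B C x)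
        (trans (cong₂ (normForm A B C)
            (proportional⇒≡ A B (+ e₁ x) (+ e₁ y) (+ e₂ x) (+ e₂ y) aB≡bA)
            (proportional⇒≡ A C (+ e₁ x) (+ e₁ y) (+ e₃ x) (+ e₃ y) aC≡cA))
          (sym (productOfValues-normForm A B C y)))))

  -- For B ≠ 0 this is -B³ times the value of the monic cubic with coefficients `s`, `t`, `w` at the
  -- root -C / B of Q.
  linearForm : ℤ → ℤ → ℤ → ℤ → ℤ → ℤ
  linearForm B C s t w = C *ᶻ C *ᶻ C -ᶻ C *ᶻ C *ᶻ B *ᶻ s +ᶻ C *ᶻ B *ᶻ B *ᶻ t -ᶻ B *ᶻ B *ᶻ B *ᶻ w

  productOfValues-linearForm : ∀ B C x → productOfValues 0ℤ B C x ≡ linearForm B C (+ e₁ x) (+ e₂ x) (+ e₃ x)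
  productOfValues-linearForm B C (x , y , z) = trans (expand B C (+ x) (+ y) (+ z))
    (cong₂ (linearForm B C (+ x +ᶻ + y +ᶻ + z)) (sym (pos-e₂ x y z)) (sym (pos-e₃ x y z)))
    where
    expand : ∀ B C x y z →
      (0ℤ *ᶻ (x *ᶻ x) -ᶻ B *ᶻ x +ᶻ C) *ᶻ (0ℤ *ᶻ (y *ᶻ y) -ᶻ B *ᶻ y +ᶻ C) *ᶻ (0ℤ *ᶻ (z *ᶻ z) -ᶻ B *ᶻ z +ᶻ C) ≡
      C *ᶻ C *ᶻ C -ᶻ C *ᶻ C *ᶻ B *ᶻ (x +ᶻ y +ᶻ z) +ᶻ C *ᶻ B *ᶻ B *ᶻ (x *ᶻ y +ᶻ y *ᶻ z +ᶻ z *ᶻ x) -ᶻ B *ᶻ B *ᶻ B *ᶻ (x *ᶻ y *ᶻ z)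
    expand = ℤ-ring

  productOfValues-linear : ∀ B C x y →
    (+ e₁ x -ᶻ + e₁ y) *ᶻ (C *ᶻ C) -ᶻ (+ e₂ x -ᶻ + e₂ y) *ᶻ (B *ᶻ C) +ᶻ (+ e₃ x -ᶻ + e₃ y) *ᶻ (B *ᶻ B) ≡ 0ℤ →
    productOfValues 0ℤ B C x ≡ productOfValues 0ℤ B C y
  productOfValues-linear B C x y eq = ℤ.i-j≡0⇒i≡j _ _
    (trans (cong₂ _-ᶻ_ (productOfValues-linearForm B C x) (productOfValues-linearForm B C y))
      (trans (regroup B C (+ e₁ x) (+ e₁ y) (+ e₂ x) (+ e₂ y) (+ e₃ x) (+ e₃ y))
        (trans (cong (-ᶻ B *ᶻ_) eq) (ℤ.*-zeroʳ (-ᶻ B)))))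
    where
    regroup : ∀ B C s s′ t t′ w w′ →
      C *ᶻ C *ᶻ C -ᶻ C *ᶻ C *ᶻ B *ᶻ s +ᶻ C *ᶻ B *ᶻ B *ᶻ t -ᶻ B *ᶻ B *ᶻ B *ᶻ w -ᶻ
        (C *ᶻ C *ᶻ C -ᶻ C *ᶻ C *ᶻ B *ᶻ s′ +ᶻ C *ᶻ B *ᶻ B *ᶻ t′ -ᶻ B *ᶻ B *ᶻ B *ᶻ w′) ≡
      -ᶻ B *ᶻ ((s -ᶻ s′) *ᶻ (C *ᶻ C) -ᶻ (t -ᶻ t′) *ᶻ (B *ᶻ C) +ᶻ (w -ᶻ w′) *ᶻ (B *ᶻ B))
    regroup = ℤ-ring

  shiftedProduct : ℤ → ℕ × ℕ × ℕ → ℤ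
  shiftedProduct L = ∏³ _*ᶻ_ (λ x → L +ᶻ + x)

  cubicEnergy : ℕ → ℤ → ℕ
  cubicEnergy p L = ∑ triples λ y → ∑ triples λ x → 𝟙 (+ p ∣ᶻ? shiftedProduct L x -ᶻ shiftedProduct L y)

  module _ {p} (pp : Prime p) (1000N^8<p : 1000 * N ^ 8 < p) (L : ℤ)
    (unit : ∀ x → 1 ≤ x → x ≤ N → ¬ (+ p ∣ᶻ L +ᶻ + x)) where

    -- The coefficients of (s + x₁) (s + x₂) (s + x₃) - (s + y₁) (s + y₂) (s + y₃)
    -- for the solutions (x , y) of the congruence.
    data Difference : ℤ → ℤ → ℤ → Set where
      difference : ∀ x y → InBox x → InBox y → + p ∣ᶻ shiftedProduct L x -ᶻ shiftedProduct L y →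
        Difference (+ e₁ x -ᶻ + e₁ y) (+ e₂ x -ᶻ + e₂ y) (+ e₃ x -ᶻ + e₃ y)

    private
      root-identity : ∀ L x₁ x₂ x₃ y₁ y₂ y₃ →
        (L +ᶻ x₁) *ᶻ (L +ᶻ x₂) *ᶻ (L +ᶻ x₃) -ᶻ (L +ᶻ y₁) *ᶻ (L +ᶻ y₂) *ᶻ (L +ᶻ y₃) ≡
        (x₁ +ᶻ x₂ +ᶻ x₃ -ᶻ (y₁ +ᶻ y₂ +ᶻ y₃)) *ᶻ (L *ᶻ L) +ᶻ
        (x₁ *ᶻ x₂ +ᶻ x₂ *ᶻ x₃ +ᶻ x₃ *ᶻ x₁ -ᶻ (y₁ *ᶻ y₂ +ᶻ y₂ *ᶻ y₃ +ᶻ y₃ *ᶻ y₁)) *ᶻ L +ᶻ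
        (x₁ *ᶻ x₂ *ᶻ x₃ -ᶻ y₁ *ᶻ y₂ *ᶻ y₃)
      root-identity = ℤ-ring

    difference-root : ∀ {a b c} → Difference a b c → + p ∣ᶻ a *ᶻ (L *ᶻ L) +ᶻ b *ᶻ L +ᶻ c
    difference-root (difference (x₁ , x₂ , x₃) (y₁ , y₂ , y₃) _ _ h) = subst (+ p ∣ᶻ_)
      (trans (root-identity L (+ x₁) (+ x₂) (+ x₃) (+ y₁) (+ y₂) (+ y₃))
        (sym (cong₂ (λ b c → (+ x₁ +ᶻ + x₂ +ᶻ + x₃ -ᶻ (+ y₁ +ᶻ + y₂ +ᶻ + y₃)) *ᶻ (L *ᶻ L) +ᶻ b *ᶻ L +ᶻ c)
          (cong₂ _-ᶻ_ (pos-e₂ x₁ x₂ x₃) (pos-e₂ y₁ y₂ y₃))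
          (cong₂ _-ᶻ_ (pos-e₃ x₁ x₂ x₃) (pos-e₃ y₁ y₂ y₃))))) h

    common-factor : ¬ ¬ CommonFactor Difference
    common-factor = commonFactor pp 1000N^8<p L unit Difference
      (λ { (difference x y hx hy _) → mk≼ (abs-difference-≤ (e₁≤ x hx) (e₁≤ y hy)) })
      (λ { (difference x y hx hy _) → mk≼ (abs-difference-≤ (e₂≤ x hx) (e₂≤ y hy)) })
      (λ { (difference x y hx hy _) → mk≼ (abs-difference-≤ (e₃≤ x hx) (e₃≤ y hy)) })
      difference-root

    module _ (factor : CommonFactor Difference) where
      open CommonFactor factor

      g : ℕ → ℤ
      g x = value A B C (+ x)

      h : ℕ → ℕ
      h x = abs (g x)

      -- Three arguments with the same value make the divided differences A (x + y) - B and A (x +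
      -- z) - B vanish; subtracting them gives A = 0, then B = 0, against `nonconstant`.
      g-fibre : ∀ v → ∑ interval (λ x → 𝟙 (g x ℤ.≟ v)) ≤ 2
      g-fibre v = ∑𝟙≤2 (λ x → g x ℤ.≟ v) interval-unique λ {x} {y} {z} gx gy gz x≢y x≢z →
        decidable-stable (y ℕ.≟ z) λ y≢z →
          let A≡0 = *-cancel-≡0 (+ y -ᶻ + z) A (sub≢0 y≢z) (trans (subtract A B (+ x) (+ y) (+ z))
                      (cong₂ _-ᶻ_ (quotient-≡0 x≢y (trans gx (sym gy))) (quotient-≡0 x≢z (trans gx (sym gz)))))
              B≡0 = trans (rearrange A B (+ x +ᶻ + y)) (cong₂ (λ s t → s *ᶻ (+ x +ᶻ + y) -ᶻ t) A≡0
                      (quotient-≡0 x≢y (trans gx (sym gy))))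
          in nonconstant (A≡0 , B≡0)
        where
        sub≢0 : ∀ {x y} → x ≢ y → + x -ᶻ + y ≢ 0ℤ
        sub≢0 {x} {y} x≢y eq = x≢y (ℤ.+-injective (ℤ.i-j≡0⇒i≡j (+ x) (+ y) eq))
        divided : ∀ A B C x y → (x -ᶻ y) *ᶻ (A *ᶻ (x +ᶻ y) -ᶻ B) ≡ value A B C x -ᶻ value A B C y
        divided = identity
          where
          identity : ∀ A B C x y → (x -ᶻ y) *ᶻ (A *ᶻ (x +ᶻ y) -ᶻ B) ≡
            A *ᶻ (x *ᶻ x) -ᶻ B *ᶻ x +ᶻ C -ᶻ (A *ᶻ (y *ᶻ y) -ᶻ B *ᶻ y +ᶻ C)
          identity = ℤ-ring
        subtract : ∀ A B x y z → (y -ᶻ z) *ᶻ A ≡ (A *ᶻ (x +ᶻ y) -ᶻ B) -ᶻ (A *ᶻ (x +ᶻ z) -ᶻ B)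
        subtract = ℤ-ring
        rearrange : ∀ A B s → B ≡ A *ᶻ s -ᶻ (A *ᶻ s -ᶻ B)
        rearrange = ℤ-ring
        quotient-≡0 : ∀ {x y} → x ≢ y → g x ≡ g y → A *ᶻ (+ x +ᶻ + y) -ᶻ B ≡ 0ℤ
        quotient-≡0 {x} {y} x≢y eq = *-cancel-≡0 (+ x -ᶻ + y) _ (sub≢0 x≢y)
          (trans (divided A B C (+ x) (+ y)) (ℤ.i≡j⇒i-j≡0 eq))

      h-fibre : ∀ d → ∑ interval (λ x → 𝟙 (h x ℕ.≟ d)) ≤ 4
      h-fibre d = begin
        ∑ interval (λ x → 𝟙 (h x ℕ.≟ d))                                ≤⟨ ∑-mono interval signs ⟩
        ∑ interval (λ x → 𝟙 (g x ℤ.≟ + d) + 𝟙 (g x ℤ.≟ -ᶻ + d))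
          ≡⟨ ∑-+ interval (λ x → 𝟙 (g x ℤ.≟ + d)) (λ x → 𝟙 (g x ℤ.≟ -ᶻ + d)) ⟩
        ∑ interval (λ x → 𝟙 (g x ℤ.≟ + d)) + ∑ interval (λ x → 𝟙 (g x ℤ.≟ -ᶻ + d))
          ≤⟨ +-mono-≤ (g-fibre (+ d)) (g-fibre (-ᶻ + d)) ⟩
        4                                                               ∎
        where
        open ≤-Reasoning
        counted : ∀ x v → g x ≡ v → 1 ≤ 𝟙 (g x ℤ.≟ v)
        counted x v eq = ≤-reflexive (sym (𝟙-yes (g x ℤ.≟ v) eq))
        signs : ∀ x → 𝟙 (h x ℕ.≟ d) ≤ 𝟙 (g x ℤ.≟ + d) + 𝟙 (g x ℤ.≟ -ᶻ + d)
        signs x = 𝟙-≤ (h x ℕ.≟ d) λ eq →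
          [ (λ e → ≤-trans (counted x (+ d) (trans (sym e) (cong +_ eq))) (m≤m+n _ _))
          , (λ e → ≤-trans
              (counted x (-ᶻ + d) (trans (sym (ℤ.neg-involutive (g x))) (cong -ᶻ_ (trans (sym e) (cong +_ eq)))))
              (m≤n+m _ (𝟙 (g x ℤ.≟ + d))))
          ]′ (ℤ.+∣i∣≡i⊎+∣i∣≡-i (g x))

      h-positive : ∀ x → 1 ≤ x → x ≤ N → 1 ≤ h x
      h-positive x 1≤x x≤N = n≢0⇒n>0 λ eq → value≢0 x 1≤x x≤N (ℤ.∣i∣≡0⇒i≡0 eq)

      h-bounded : ∀ x → x ≤ N → h x ≤ 24 * N ^ 4
      h-bounded x x≤N = _≼_·N^_.bound (value-bounded x x≤N)

      norm : ℕ × ℕ × ℕ → ℕ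
      norm = ∏³ _*_ h

      norm-abs : ∀ t → norm t ≡ abs (productOfValues A B C t)
      norm-abs (x , y , z) = sym (trans (ℤ.abs-* (g x *ᶻ g y) (g z)) (cong (_* h z) (ℤ.abs-* (g x) (g y))))

      norm-≡ : ∀ x y → InBox x → InBox y → + p ∣ᶻ shiftedProduct L x -ᶻ shiftedProduct L y → norm x ≡ norm y
      norm-≡ x y hx hy p∣xy = trans (norm-abs x) (trans
        (cong abs (products-agree (multiples (difference x y hx hy p∣xy)))) (sym (norm-abs y)))
        where
        a = + e₁ x -ᶻ + e₁ y
        b = + e₂ x -ᶻ + e₂ y
        c = + e₃ x -ᶻ + e₃ y
        products-agree : (A ≢ 0ℤ × a *ᶻ B ≡ b *ᶻ A × a *ᶻ C ≡ c *ᶻ A) ⊎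
          (A ≡ 0ℤ × a *ᶻ (C *ᶻ C) -ᶻ b *ᶻ (B *ᶻ C) +ᶻ c *ᶻ (B *ᶻ B) ≡ 0ℤ) →
          productOfValues A B C x ≡ productOfValues A B C y
        products-agree (inj₁ (A≢0 , aB≡bA , aC≡cA)) = productOfValues-quadratic A B C x y A≢0 aB≡bA aC≡cA
        products-agree (inj₂ (A≡0 , eq)) = subst (λ A → productOfValues A B C x ≡ productOfValues A B C y) (sym A≡0)
          (productOfValues-linear B C x y eq)

      norm-positive : ∀ t → InBox t → 1 ≤ norm t
      norm-positive (x , y , z) ((hx , hx′) , (hy , hy′) , (hz , hz′)) =
        *-mono-≤ (*-mono-≤ (h-positive x hx hx′) (h-positive y hy hy′)) (h-positive z hz hz′)

      norm-bounded : ∀ t → InBox t → norm t ≤ (24 * N ^ 4) ^ 3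
      norm-bounded (x , y , z) ((_ , hx) , (_ , hy) , (_ , hz)) = ≤-trans
        (*-mono-≤ (*-mono-≤ (h-bounded x hx) (h-bounded y hy)) (h-bounded z hz)) (≤-reflexive (cube (24 * N ^ 4)))
        where
        cube : ∀ k → k * k * k ≡ k * (k * (k * 1))
        cube = ℕ-ring

      -- Both `h x` and `h y` are divisors of `n`, which leaves 4 T choices for each of x and y.
      -- They determine `h z`, which leaves 4 choices of z.
      norm-fibre : ∀ n T → 1 ≤ n → DivisorBound n T → ∑ triples (λ x → 𝟙 (norm x ℕ.≟ n)) ≤ 64 * (T * T)
      norm-fibre n T 1≤n bound = begin
        ∑ triples (λ x → 𝟙 (norm x ℕ.≟ n))
          ≡⟨ ∑-cartesianProduct interval (cartesianProduct interval interval) (λ x → 𝟙 (norm x ℕ.≟ n)) ⟩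
        ∑ interval (λ x → ∑ (cartesianProduct interval interval) λ t → 𝟙 (norm (x , t) ℕ.≟ n))
                                                                            ≤⟨ ∑-mono interval inner ⟩
        ∑ interval (λ x → 𝟙 (h x ∣? n) * (T * 4 * 4))
          ≡⟨ ∑-*ʳ interval (λ x → 𝟙 (h x ∣? n)) (T * 4 * 4) ⟩
        ∑ interval (λ x → 𝟙 (h x ∣? n)) * (T * 4 * 4)
          ≤⟨ *-monoˡ-≤ (T * 4 * 4) count-divisors ⟩
        T * 4 * (T * 4 * 4)                                                 ≡⟨ regroup T ⟩
        64 * (T * T)                                                        ∎
        where
        open ≤-Reasoning
        regroup : ∀ T → T * 4 * (T * 4 * 4) ≡ 64 * (T * T)
        regroup = ℕ-ring
        count-divisors : ∑ interval (λ x → 𝟙 (h x ∣? n)) ≤ T * 4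
        count-divisors = ∑-divides h interval 4 h-fibre 1≤n bound
        last : ∀ x y → ∑ interval (λ z → 𝟙 (h x * h y * h z ℕ.≟ n)) ≤ 𝟙 (h x ∣? n) * (𝟙 (h y ∣? n) * 4)
        last x y with h x ∣? n | h y ∣? n
        ... | no hx∤n | _ = ≤-reflexive (∑-all-zero interval λ {z} _ → 𝟙-no (h x * h y * h z ℕ.≟ n)
                λ { refl → hx∤n (∣m⇒∣m*n (h z) (∣m⇒∣m*n (h y) ∣-refl)) })
        ... | yes _ | no hy∤n = ≤-reflexive (∑-all-zero interval λ {z} _ → 𝟙-no (h x * h y * h z ℕ.≟ n)
                λ { refl → hy∤n (∣m⇒∣m*n (h z) (∣n⇒∣m*n (h x) ∣-refl)) })
        ... | yes _ | yes _ with h x * h y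
        ...   | zero  = ≤-trans (≤-reflexive (∑-all-zero interval λ _ →
                  𝟙-no (0 ℕ.≟ n) λ { refl → contradiction 1≤n λ () })) z≤n
        ...   | k@(suc _) = begin
          ∑ interval (λ z → 𝟙 (k * h z ℕ.≟ n))   ≤⟨ ∑-mono interval (λ z → 𝟙-mono (k * h z ℕ.≟ n) (h z ℕ.≟ n / k) λ e →
                                                       trans (sym (m*n/n≡m (h z) k)) (cong (_/ k) (trans (*-comm (h z) k) e))) ⟩
          ∑ interval (λ z → 𝟙 (h z ℕ.≟ n / k))   ≤⟨ h-fibre (n / k) ⟩
          4                                      ∎
        inner : ∀ x → ∑ (cartesianProduct interval interval) (λ t → 𝟙 (norm (x , t) ℕ.≟ n)) ≤ 𝟙 (h x ∣? n) * (T * 4 * 4)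
        inner x = begin
          ∑ (cartesianProduct interval interval) (λ t → 𝟙 (norm (x , t) ℕ.≟ n))
            ≡⟨ ∑-cartesianProduct interval interval (λ t → 𝟙 (norm (x , t) ℕ.≟ n)) ⟩
          ∑ interval (λ y → ∑ interval λ z → 𝟙 (h x * h y * h z ℕ.≟ n))   ≤⟨ ∑-mono interval (last x) ⟩
          ∑ interval (λ y → 𝟙 (h x ∣? n) * (𝟙 (h y ∣? n) * 4))
            ≡⟨ ∑-*ˡ interval (𝟙 (h x ∣? n)) (λ y → 𝟙 (h y ∣? n) * 4) ⟩
          𝟙 (h x ∣? n) * ∑ interval (λ y → 𝟙 (h y ∣? n) * 4)
            ≡⟨ cong (𝟙 (h x ∣? n) *_) (∑-*ʳ interval (λ y → 𝟙 (h y ∣? n)) 4) ⟩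
          𝟙 (h x ∣? n) * (∑ interval (λ y → 𝟙 (h y ∣? n)) * 4)
            ≤⟨ *-monoʳ-≤ (𝟙 (h x ∣? n)) (*-monoˡ-≤ 4 count-divisors) ⟩
          𝟙 (h x ∣? n) * (T * 4 * 4)                                      ∎

      solutions-bounded : ∀ m → 1 ≤ m → ∀ y → InBox y →
        ∑ triples (λ x → 𝟙 (+ p ∣ᶻ? shiftedProduct L x -ᶻ shiftedProduct L y)) ^ m ≤
        64 ^ m * (divisorConstant m * (24 * N ^ 4) ^ 3 * (divisorConstant m * (24 * N ^ 4) ^ 3))
      solutions-bounded m 1≤m y hy with T , bound , T^m≤ ← divisorBound m 1≤m (norm y) (norm-positive y hy) = begin
        ∑ triples (λ x → 𝟙 (+ p ∣ᶻ? shiftedProduct L x -ᶻ shiftedProduct L y)) ^ m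
                                              ≤⟨ ^-monoˡ-≤ m (∑-mono∈ triples λ {x} x∈ →
                                                   𝟙-mono (+ p ∣ᶻ? _) (norm x ℕ.≟ norm y) (norm-≡ x y (∈-triples x∈) hy)) ⟩
        ∑ triples (λ x → 𝟙 (norm x ℕ.≟ norm y)) ^ m
                                              ≤⟨ ^-monoˡ-≤ m (norm-fibre (norm y) T (norm-positive y hy) bound) ⟩
        (64 * (T * T)) ^ m                    ≡⟨ ^-distribʳ-* 64 (T * T) m ⟩
        64 ^ m * (T * T) ^ m                  ≡⟨ cong (64 ^ m *_) (^-distribʳ-* T T m) ⟩
        64 ^ m * (T ^ m * T ^ m)              ≤⟨ *-monoʳ-≤ (64 ^ m) (*-mono-≤ T^m≤Z T^m≤Z) ⟩
        64 ^ m * (Z * Z)                      ∎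
        where
        open ≤-Reasoning
        Z = divisorConstant m * (24 * N ^ 4) ^ 3
        T^m≤Z : T ^ m ≤ Z
        T^m≤Z = ≤-trans T^m≤ (*-monoʳ-≤ (divisorConstant m) (norm-bounded y hy))

    length-triples : length triples ≡ N ^ 3
    length-triples = trans (length-cartesianProduct interval (cartesianProduct interval interval))
      (trans (cong₂ _*_ (length-applyUpTo suc N) (trans (length-cartesianProduct interval interval)
        (cong₂ _*_ (length-applyUpTo suc N) (length-applyUpTo suc N)))) (cube N))
      where
      cube : ∀ k → k * (k * k) ≡ k * (k * (k * 1))
      cube = ℕ-ring

    -- The inequality is decidable, so the double negation of `common-factor` can be removed here.
    -- The 24 is twice 12, as T^m = O(N^12) enters squared.
    cubicEnergy-bounded : ∀ m → 1 ≤ m → cubicEnergy p L ^ m ≤ energyConstant m * N ^ (3 * m + 24)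
    cubicEnergy-bounded m 1≤m = decidable-stable (_ ≤? _) λ ¬bounded → common-factor λ factor → ¬bounded (begin
      cubicEnergy p L ^ m
        ≤⟨ ∑-^-≤ triples _ m _ {{>-nonZero 1≤m}} (λ {y} y∈ → solutions-bounded factor m 1≤m y (∈-triples y∈)) ⟩
      length triples ^ m * (64 ^ m * (Z * Z))
        ≡⟨ cong (λ k → k ^ m * (64 ^ m * (Z * Z))) length-triples ⟩
      (N ^ 3) ^ m * (64 ^ m * (Z * Z))
        ≡⟨ cong₂ (λ k l → k * (64 ^ m * (l * l))) (^-*-assoc N 3 m) Z≡ ⟩
      N ^ (3 * m) * (64 ^ m * (c * N ^ 12 * (c * N ^ 12))) ≡⟨ regroup (N ^ (3 * m)) (64 ^ m) c (N ^ 12) ⟩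
      energyConstant m * (N ^ (3 * m) * (N ^ 12 * N ^ 12))
        ≡⟨ cong (λ k → energyConstant m * (N ^ (3 * m) * k)) (sym (^-distribˡ-+-* N 12 12)) ⟩
      energyConstant m * (N ^ (3 * m) * N ^ 24)
        ≡⟨ cong (energyConstant m *_) (sym (^-distribˡ-+-* N (3 * m) 24)) ⟩
      energyConstant m * N ^ (3 * m + 24)             ∎)
      where
      open ≤-Reasoning
      Z = divisorConstant m * (24 * N ^ 4) ^ 3
      c = divisorConstant m * 24 ^ 3
      Z≡ : Z ≡ c * N ^ 12
      Z≡ = trans (cong (divisorConstant m *_) (trans (^-distribʳ-* 24 (N ^ 4) 3) (cong (24 ^ 3 *_) (^-*-assoc N 4 3))))
        (sym (*-assoc (divisorConstant m) (24 ^ 3) (N ^ 12)))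
      regroup : ∀ a b c d → a * (b * (c * d * (c * d))) ≡ b * (c * c) * (a * (d * d))
      regroup = ℕ-ring

-- Coincidences of fractions modulo p and Hölder's inequality for energies

∑-cartesianProduct³ : {A B C : Set} (as : List A) (bs : List B) (cs : List C) (f : A × B × C → ℕ) →
  ∑ (cartesianProduct as (cartesianProduct bs cs)) f ≡ ∑ as λ a → ∑ bs λ b → ∑ cs λ c → f (a , b , c)
∑-cartesianProduct³ as bs cs f = trans (∑-cartesianProduct as (cartesianProduct bs cs) f)
  (∑-cong as λ a → ∑-cartesianProduct bs cs (λ t → f (a , t)))

module Energy {p : ℕ} (pp : Prime p) where

  Unit : ℤ → Set
  Unit z = ¬ (+ p ∣ᶻ z)

  private instance
    p≢0 : NonZero p
    p≢0 = prime⇒nonZero pp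

  p∣?_ : ∀ z → Dec (+ p ∣ᶻ z)
  p∣? z = + p ∣ᶻ? z

  unit-1 : Unit 1ℤ
  unit-1 h = contradiction (∣∧small⇒≡0 1ℤ (nonTrivial⇒n>1 p {{prime⇒nonTrivial pp}}) h) λ ()

  inverse : ∀ b → Unit b → ∃[ b′ ] + p ∣ᶻ b *ᶻ b′ -ᶻ 1ℤ
  inverse b unit-b = signed (ℤ.+∣i∣≡i⊎+∣i∣≡-i b) (bézout (coprime-Bézout (prime∤⇒coprime pp (unit-b ∘ ℤ∣.∣ᵤ⇒∣))))
    where
    k = abs b
    bézout : Bézout.Identity 1 k p → ∃[ k′ ] + p ∣ᶻ + k *ᶻ k′ -ᶻ 1ℤ
    bézout (Bézout.+- x y eq) = + x , ℤ∣.divides (+ y) (trans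
      (cong (λ z → z -ᶻ 1ℤ) (trans (ℤ.*-comm (+ k) (+ x)) (trans (sym (ℤ.pos-* x k)) (cong +_ (sym eq)))))
      (trans (cong (λ z → 1ℤ +ᶻ z -ᶻ 1ℤ) (ℤ.pos-* y p)) (cancel (+ y *ᶻ + p))))
      where
      cancel : ∀ z → 1ℤ +ᶻ z -ᶻ 1ℤ ≡ z
      cancel = ℤ-ring
    bézout (Bézout.-+ x y eq) = -ᶻ + x , ℤ∣.divides (-ᶻ + y) (trans (regroup (+ k) (+ x)) (trans
      (cong -ᶻ_ (trans (cong (1ℤ +ᶻ_) (sym (ℤ.pos-* x k))) (trans (cong +_ eq) (ℤ.pos-* y p)))) (ℤ.neg-distribˡ-* (+ y) (+ p))))
      where
      regroup : ∀ k x → k *ᶻ -ᶻ x -ᶻ 1ℤ ≡ -ᶻ (1ℤ +ᶻ x *ᶻ k)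
      regroup = ℤ-ring
    signed : (+ k ≡ b) ⊎ (+ k ≡ -ᶻ b) → ∃[ k′ ] + p ∣ᶻ + k *ᶻ k′ -ᶻ 1ℤ → ∃[ b′ ] + p ∣ᶻ b *ᶻ b′ -ᶻ 1ℤ
    signed (inj₁ eq) (k′ , h) = k′ , subst (λ z → + p ∣ᶻ z *ᶻ k′ -ᶻ 1ℤ) eq h
    signed (inj₂ eq) (k′ , h) = -ᶻ k′ , subst (λ z → + p ∣ᶻ z -ᶻ 1ℤ) (trans (cong (_*ᶻ k′) eq) (move b k′)) h
      where
      move : ∀ b k → -ᶻ b *ᶻ k ≡ b *ᶻ -ᶻ k
      move = ℤ-ring

  quotientResidue : ∀ a b → Unit b → ∃[ w ] w < p × + p ∣ᶻ a -ᶻ + w *ᶻ b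
  quotientResidue a b unit-b with b′ , p∣bb′-1 ← inverse b unit-b =
    w , n%ℕd<d (a *ᶻ b′) p , subst (+ p ∣ᶻ_) (sym (trans (cong (λ z → a -ᶻ z *ᶻ b) w≡) (regroup a b b′ (q *ᶻ + p))))
      (ℤ∣.∣m∣n⇒∣m-n (ℤ∣.∣n⇒∣m*n b (ℤ∣.∣n⇒∣m*n q ℤ∣.∣-refl)) (ℤ∣.∣n⇒∣m*n a p∣bb′-1))
    where
    w = (a *ᶻ b′) %ℕ p
    q = (a *ᶻ b′) ℤ./ℕ p
    isolate : ∀ w z → w ≡ w +ᶻ z -ᶻ z
    isolate = ℤ-ring
    w≡ : + w ≡ a *ᶻ b′ -ᶻ q *ᶻ + p
    w≡ = trans (isolate (+ w) (q *ᶻ + p)) (cong (_-ᶻ q *ᶻ + p) (sym (a≡a%ℕn+[a/ℕn]*n (a *ᶻ b′) p)))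
    regroup : ∀ a b b′ z → a -ᶻ (a *ᶻ b′ -ᶻ z) *ᶻ b ≡ b *ᶻ z -ᶻ a *ᶻ (b *ᶻ b′ -ᶻ 1ℤ)
    regroup = ℤ-ring

  residue-unique : ∀ {w w′} → w < p → w′ < p → + p ∣ᶻ + w -ᶻ + w′ → w ≡ w′
  residue-unique {w} {w′} w<p w′<p h = ℤ.+-injective (ℤ.i-j≡0⇒i≡j _ _ (∣∧small⇒≡0 _ small h))
    where
    small : abs (+ w -ᶻ + w′) < p
    small = ≤-<-trans (≤-reflexive (cong abs (ℤ.m-n≡m⊖n w w′))) (≤-<-trans (ℤ.∣m⊝n∣≤m⊔n w w′) (⊔-pres-<m w<p w′<p))

  -- The pair (a , b) stands for the residue a / b when b is a unit. Coincidence of two fractions is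
  -- tested by cross multiplication, so no choice of inverses enters the counts.
  Fraction : Set
  Fraction = ℤ × ℤ

  coincide : Fraction → Fraction → ℕ
  coincide (a , b) (c , d) = 𝟙 (p∣? (a *ᶻ d -ᶻ c *ᶻ b))

  represents : Fraction → ℕ → ℕ
  represents (a , b) w = 𝟙 (p∣? (a -ᶻ + w *ᶻ b))

  residues : List ℕ
  residues = upTo p

  quotientResidue-unique : ∀ {a b w w′} → Unit b → w < p → w′ < p →
    + p ∣ᶻ a -ᶻ + w *ᶻ b → + p ∣ᶻ a -ᶻ + w′ *ᶻ b → w ≡ w′
  quotientResidue-unique {a} {b} {w} {w′} unit-b w<p w′<p h h′ = residue-unique w<p w′<p
    ([ (λ k → k) , ⊥-elim ∘ unit-b ]′ (euclid pp (+ w -ᶻ + w′) b (subst (+ p ∣ᶻ_) (regroup a b (+ w) (+ w′)) (ℤ∣.∣m∣n⇒∣m-n h′ h))))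
    where
    regroup : ∀ a b w w′ → a -ᶻ w′ *ᶻ b -ᶻ (a -ᶻ w *ᶻ b) ≡ (w -ᶻ w′) *ᶻ b
    regroup = ℤ-ring

  ∑-represents : ∀ {a b w} → Unit b → w < p → + p ∣ᶻ a -ᶻ + w *ᶻ b → (f : ℕ → ℕ) →
    ∑ residues (λ v → represents (a , b) v * f v) ≡ f w
  ∑-represents {a} {b} {w} unit-b w<p h f = trans
    (∑-single (Unique.upTo⁺ p) (∈-upTo⁺ w<p) {λ v → represents (a , b) v * f v} λ {v} v∈ v≢w → cong (_* f v)
      (𝟙-no (p∣? (a -ᶻ + v *ᶻ b)) λ h′ → v≢w (quotientResidue-unique {a} {b} unit-b (∈-upTo⁻ v∈) w<p h′ h)))
    (trans (cong (_* f w) (𝟙-yes (p∣? (a -ᶻ + w *ᶻ b)) h)) (+-identityʳ (f w)))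

  coincide-residues : ∀ {a b c d} → Unit b → Unit d →
    coincide (a , b) (c , d) ≡ ∑ residues λ w → represents (a , b) w * represents (c , d) w
  coincide-residues {a} {b} {c} {d} unit-b unit-d = at (quotientResidue a b unit-b)
    where
    toward : ∀ a b c d w → d *ᶻ (a -ᶻ w *ᶻ b) -ᶻ (a *ᶻ d -ᶻ c *ᶻ b) ≡ b *ᶻ (c -ᶻ w *ᶻ d)
    toward = ℤ-ring
    back : ∀ a b c d w → d *ᶻ (a -ᶻ w *ᶻ b) -ᶻ b *ᶻ (c -ᶻ w *ᶻ d) ≡ a *ᶻ d -ᶻ c *ᶻ b
    back = ℤ-ring
    to : ∀ w → + p ∣ᶻ a -ᶻ + w *ᶻ b → + p ∣ᶻ a *ᶻ d -ᶻ c *ᶻ b → + p ∣ᶻ c -ᶻ + w *ᶻ d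
    to w h k = [ ⊥-elim ∘ unit-b , (λ l → l) ]′ (euclid pp b (c -ᶻ + w *ᶻ d)
      (subst (+ p ∣ᶻ_) (toward a b c d (+ w)) (ℤ∣.∣m∣n⇒∣m-n (ℤ∣.∣n⇒∣m*n d h) k)))
    from : ∀ w → + p ∣ᶻ a -ᶻ + w *ᶻ b → + p ∣ᶻ c -ᶻ + w *ᶻ d → + p ∣ᶻ a *ᶻ d -ᶻ c *ᶻ b
    from w h k = subst (+ p ∣ᶻ_) (back a b c d (+ w)) (ℤ∣.∣m∣n⇒∣m-n (ℤ∣.∣n⇒∣m*n d h) (ℤ∣.∣n⇒∣m*n b k))
    at : ∃[ w ] w < p × + p ∣ᶻ a -ᶻ + w *ᶻ b →
      coincide (a , b) (c , d) ≡ ∑ residues λ w → represents (a , b) w * represents (c , d) w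
    at (w , w<p , h) = trans (𝟙-cong (p∣? (a *ᶻ d -ᶻ c *ᶻ b)) (p∣? (c -ᶻ + w *ᶻ d)) (to w h) (from w h))
      (sym (∑-represents {a} {b} unit-b w<p h (represents (c , d))))

  representations : List Fraction → ℕ → ℕ
  representations fs w = ∑ fs λ f → represents f w

  coincidences : List Fraction → List Fraction → ℕ
  coincidences fs gs = ∑ fs λ f → ∑ gs λ g → coincide f g

  UnitDenominators : List Fraction → Set
  UnitDenominators fs = ∀ {f} → f ∈ fs → Unit (proj₂ f)

  -- Sorting the coincident pairs by their common residue `w` turns the count into an inner product
  -- of two representation functions, which is the form that Cauchy-Schwarz needs.
  coincidences-residues : ∀ {fs gs} → UnitDenominators fs → UnitDenominators gs →
    coincidences fs gs ≡ ∑ residues λ w → representations fs w * representations gs w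
  coincidences-residues {fs} {gs} hf hg = begin
    (∑ fs λ f → ∑ gs λ g → coincide f g)
      ≡⟨ (∑-cong∈ fs λ {f} f∈ → ∑-cong∈ gs λ {g} g∈ → coincide-residues {proj₁ f} {proj₂ f} {proj₁ g} {proj₂ g} (hf f∈) (hg g∈)) ⟩
    (∑ fs λ f → ∑ gs λ g → ∑ residues λ w → represents f w * represents g w)
      ≡⟨ (∑-cong fs λ f → ∑-swap gs residues λ g w → represents f w * represents g w) ⟩
    (∑ fs λ f → ∑ residues λ w → ∑ gs λ g → represents f w * represents g w)
      ≡⟨ ∑-swap fs residues (λ f w → ∑ gs λ g → represents f w * represents g w) ⟩
    (∑ residues λ w → ∑ fs λ f → ∑ gs λ g → represents f w * represents g w)
      ≡⟨ (∑-cong residues λ w → sym (∑-*-∑ fs gs (λ f → represents f w) (λ g → represents g w))) ⟩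
    (∑ residues λ w → representations fs w * representations gs w) ∎
    where open ≡-Reasoning

  coincidences-cauchy-schwarz : ∀ {fs gs} → UnitDenominators fs → UnitDenominators gs →
    coincidences fs gs * coincidences fs gs ≤ coincidences fs fs * coincidences gs gs
  coincidences-cauchy-schwarz {fs} {gs} hf hg = begin
    coincidences fs gs * coincidences fs gs
      ≡⟨ cong (λ k → k * k) (coincidences-residues hf hg) ⟩
    ∑ residues (λ w → representations fs w * representations gs w) *
    ∑ residues (λ w → representations fs w * representations gs w)
      ≤⟨ cauchy-schwarz residues (representations fs) (representations gs) ⟩
    ∑ residues (λ w → representations fs w * representations fs w) *
    ∑ residues (λ w → representations gs w * representations gs w)
      ≡⟨ sym (cong₂ _*_ (coincidences-residues hf hf) (coincidences-residues hg hg)) ⟩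
    coincidences fs fs * coincidences gs gs ∎
    where open ≤-Reasoning

  -- Cauchy-Schwarz against the indicator of `P`: a fraction with unit denominator represents
  -- exactly one residue, so the representation function sums to `length fs`, and its square sums to
  -- the number of coincidences.
  support-bound : ∀ {fs} → UnitDenominators fs → {P : ℕ → Set} (P? : ∀ w → Dec (P w)) →
    (∀ w → w < p → 1 ≤ representations fs w → P w) →
    length fs * length fs ≤ ∑ residues (λ w → 𝟙 (P? w)) * coincidences fs fs
  support-bound {fs} hf P? supported = begin
    length fs * length fs
      ≡⟨ cong (λ k → k * k) (sym total) ⟩
    ∑ residues (λ w → 𝟙 (P? w) * representations fs w) * ∑ residues (λ w → 𝟙 (P? w) * representations fs w)
      ≤⟨ cauchy-schwarz residues (λ w → 𝟙 (P? w)) (representations fs) ⟩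
    ∑ residues (λ w → 𝟙 (P? w) * 𝟙 (P? w)) * ∑ residues (λ w → representations fs w * representations fs w)
      ≡⟨ cong₂ _*_ (∑-cong residues λ w → idempotent (P? w)) (sym (coincidences-residues hf hf)) ⟩
    ∑ residues (λ w → 𝟙 (P? w)) * coincidences fs fs ∎
    where
    open ≤-Reasoning
    idempotent : ∀ {P : Set} (d : Dec P) → 𝟙 d * 𝟙 d ≡ 𝟙 d
    idempotent (yes _) = refl
    idempotent (no _)  = refl
    absorb : ∀ {w} → w ∈ residues → 𝟙 (P? w) * representations fs w ≡ representations fs w
    absorb {w} w∈ with representations fs w in eq
    ... | zero  = *-zeroʳ (𝟙 (P? w))
    ... | suc n = trans (cong (_* suc n) (𝟙-yes (P? w) (supported w (∈-upTo⁻ w∈) (subst (1 ≤_) (sym eq) (s≤s z≤n))))) (+-identityʳ _)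
    once : ∀ {f} → f ∈ fs → ∑ residues (represents f) ≡ 1
    once {a , b} f∈ = let _ , w<p , h = quotientResidue a b (hf f∈) in
      trans (∑-cong residues λ w → sym (*-identityʳ _)) (∑-represents {a} {b} (hf f∈) w<p h (λ _ → 1))
    total : ∑ residues (λ w → 𝟙 (P? w) * representations fs w) ≡ length fs
    total = trans (∑-cong∈ residues absorb) (trans (∑-swap residues fs (λ w f → represents f w))
      (trans (∑-cong∈ fs once) (trans (∑-const fs 1) (*-identityʳ _))))

  quotients³ : List ℤ → List ℤ → List Fraction
  quotients³ A B = map (λ (a , a′ , b) → a *ᶻ b , a′) (cartesianProduct A (cartesianProduct A B))

  quotients³-unit : ∀ {A B} → (∀ {a} → a ∈ A → Unit a) → UnitDenominators (quotients³ A B)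
  quotients³-unit {A} {B} hA f∈ with _ , t∈ , refl ← ∈-map⁻ _ f∈
    with _ , t∈′ ← ∈-cartesianProduct⁻ A (cartesianProduct A B) t∈
    with a′∈ , _ ← ∈-cartesianProduct⁻ A B t∈′ = hA a′∈

  ∑-quotients³ : ∀ A B (f : Fraction → ℕ) →
    ∑ (quotients³ A B) f ≡ ∑ A λ a → ∑ A λ a′ → ∑ B λ b → f (a *ᶻ b , a′)
  ∑-quotients³ A B f = trans (∑-map _ (cartesianProduct A (cartesianProduct A B)) f) (∑-cartesianProduct³ A A B _)

  -- The number of solutions of a b c′ ≡ a′ b′ c, read as a b / a′ ≡ c b′ / c′.
  energy : List ℤ → List ℤ → List ℤ → ℕ
  energy A B C = coincidences (quotients³ A B) (quotients³ C B)

  energy-expand : ∀ A B C → energy A B C ≡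
    ∑ A λ a → ∑ A λ a′ → ∑ B λ b → ∑ C λ c → ∑ C λ c′ → ∑ B λ b′ → 𝟙 (p∣? (a *ᶻ b *ᶻ c′ -ᶻ c *ᶻ b′ *ᶻ a′))
  energy-expand A B C = trans (∑-quotients³ A B _) (∑-cong A λ a → ∑-cong A λ a′ → ∑-cong B λ b → ∑-quotients³ C B _)

  productEnergy : List ℤ → List ℤ → List ℤ → ℕ
  productEnergy A B C = ∑ A λ a → ∑ B λ b → ∑ C λ c → ∑ A λ a′ → ∑ B λ b′ → ∑ C λ c′ →
    𝟙 (p∣? (a *ᶻ b *ᶻ c -ᶻ a′ *ᶻ b′ *ᶻ c′))

  -- The equation a b c ≡ a′ b′ c′ is divided by a′ c; thus `c` and `c′` exchange their roles
  -- between the two sides.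
  productEnergy≡energy : ∀ A B C → productEnergy A B C ≡ energy A B C
  productEnergy≡energy A B C = begin
    productEnergy A B C
      ≡⟨ (∑-cong A λ a → ∑-cong B λ b → ∑-swap C A _) ⟩
    (∑ A λ a → ∑ B λ b → ∑ A λ a′ → ∑ C λ c → ∑ B λ b′ → ∑ C λ c′ → 𝟙 (p∣? (a *ᶻ b *ᶻ c -ᶻ a′ *ᶻ b′ *ᶻ c′)))
      ≡⟨ (∑-cong A λ a → ∑-swap B A _) ⟩
    (∑ A λ a → ∑ A λ a′ → ∑ B λ b → ∑ C λ c → ∑ B λ b′ → ∑ C λ c′ → 𝟙 (p∣? (a *ᶻ b *ᶻ c -ᶻ a′ *ᶻ b′ *ᶻ c′)))
      ≡⟨ (∑-cong A λ a → ∑-cong A λ a′ → ∑-cong B λ b → ∑-cong C λ c → ∑-swap B C _) ⟩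
    (∑ A λ a → ∑ A λ a′ → ∑ B λ b → ∑ C λ c → ∑ C λ c′ → ∑ B λ b′ → 𝟙 (p∣? (a *ᶻ b *ᶻ c -ᶻ a′ *ᶻ b′ *ᶻ c′)))
      ≡⟨ (∑-cong A λ a → ∑-cong A λ a′ → ∑-cong B λ b → ∑-swap C C _) ⟩
    (∑ A λ a → ∑ A λ a′ → ∑ B λ b → ∑ C λ c′ → ∑ C λ c → ∑ B λ b′ → 𝟙 (p∣? (a *ᶻ b *ᶻ c -ᶻ a′ *ᶻ b′ *ᶻ c′)))
      ≡⟨ (∑-cong A λ a → ∑-cong A λ a′ → ∑-cong B λ b → ∑-cong C λ c′ → ∑-cong C λ c → ∑-cong B λ b′ →
           cong (λ z → 𝟙 (p∣? (a *ᶻ b *ᶻ c -ᶻ z))) (rotate a′ b′ c′)) ⟩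
    (∑ A λ a → ∑ A λ a′ → ∑ B λ b → ∑ C λ c′ → ∑ C λ c → ∑ B λ b′ → 𝟙 (p∣? (a *ᶻ b *ᶻ c -ᶻ c′ *ᶻ b′ *ᶻ a′)))
      ≡⟨ sym (energy-expand A B C) ⟩
    energy A B C ∎
    where
    open ≡-Reasoning
    rotate : ∀ a b c → a *ᶻ b *ᶻ c ≡ c *ᶻ b *ᶻ a
    rotate = ℤ-ring

  p∣-flip : ∀ {z w} → z ≡ -ᶻ w → 𝟙 (p∣? z) ≡ 𝟙 (p∣? w)
  p∣-flip {z} {w} refl = 𝟙-cong (p∣? (-ᶻ w)) (p∣? w)
    (λ h → subst (+ p ∣ᶻ_) (ℤ.neg-involutive w) (ℤ∣.∣m⇒∣-m h)) ℤ∣.∣m⇒∣-m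

  -- Up to renaming, both sides count the equations with two factors from `A` and one from `B` on
  -- each side.
  energy-rotate : ∀ A B → energy A B A ≡ energy A A B
  energy-rotate A B = begin
    energy A B A
      ≡⟨ energy-expand A B A ⟩
    (∑ A λ a → ∑ A λ a′ → ∑ B λ b → ∑ A λ c → ∑ A λ c′ → ∑ B λ b′ → 𝟙 (p∣? (a *ᶻ b *ᶻ c′ -ᶻ c *ᶻ b′ *ᶻ a′)))
      ≡⟨ ∑-swap A A _ ⟩
    (∑ A λ a′ → ∑ A λ a → ∑ B λ b → ∑ A λ c → ∑ A λ c′ → ∑ B λ b′ → 𝟙 (p∣? (a *ᶻ b *ᶻ c′ -ᶻ c *ᶻ b′ *ᶻ a′)))
      ≡⟨ (∑-cong A λ a′ → ∑-cong A λ a → ∑-swap B A _) ⟩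
    (∑ A λ a′ → ∑ A λ a → ∑ A λ c → ∑ B λ b → ∑ A λ c′ → ∑ B λ b′ → 𝟙 (p∣? (a *ᶻ b *ᶻ c′ -ᶻ c *ᶻ b′ *ᶻ a′)))
      ≡⟨ (∑-cong A λ a′ → ∑-cong A λ a → ∑-cong A λ c → ∑-cong B λ b → ∑-swap A B _) ⟩
    (∑ A λ a′ → ∑ A λ a → ∑ A λ c → ∑ B λ b → ∑ B λ b′ → ∑ A λ c′ → 𝟙 (p∣? (a *ᶻ b *ᶻ c′ -ᶻ c *ᶻ b′ *ᶻ a′)))
      ≡⟨ (∑-cong A λ a′ → ∑-cong A λ a → ∑-cong A λ c → ∑-cong B λ b → ∑-cong B λ b′ → ∑-cong A λ c′ →
           p∣-flip (flip a b c a′ b′ c′)) ⟩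
    (∑ A λ a′ → ∑ A λ a → ∑ A λ c → ∑ B λ b → ∑ B λ b′ → ∑ A λ c′ → 𝟙 (p∣? (a′ *ᶻ c *ᶻ b′ -ᶻ b *ᶻ c′ *ᶻ a)))
      ≡⟨ sym (energy-expand A A B) ⟩
    energy A A B ∎
    where
    open ≡-Reasoning
    flip : ∀ a b c a′ b′ c′ → a *ᶻ b *ᶻ c′ -ᶻ c *ᶻ b′ *ᶻ a′ ≡ -ᶻ (a′ *ᶻ c *ᶻ b′ -ᶻ b *ᶻ c′ *ᶻ a)
    flip = ℤ-ring

  Units : List ℤ → Set
  Units A = ∀ {a} → a ∈ A → Unit a

  -- The fraction a b / a′ involves only `A` and `B`, the fraction c b′ / c′ only `C` and `B`, so
  -- each diagonal term is an energy of just two lists.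
  energy-cauchy-schwarz : ∀ {A B C} → Units A → Units C → energy A B C * energy A B C ≤ energy A B A * energy C B C
  energy-cauchy-schwarz {A} {B} {C} hA hC =
    coincidences-cauchy-schwarz (quotients³-unit {A} {B} hA) (quotients³-unit {C} {B} hC)

  -- Cauchy-Schwarz, with the lists rotated, bounds the two mixed energies by each other: X² ≤ a Y
  -- and Y² ≤ b X. Hence X⁴ ≤ a² b X, and X cancels.
  energy-hölder₂ : ∀ {A B} → Units A → Units B → energy A B A ^ 3 ≤ energy A A A ^ 2 * energy B B B
  energy-hölder₂ {A} {B} hA hB = cancel (energy A B A) (begin
    X * X ^ 3               ≡⟨ fourth X ⟩
    (X * X) * (X * X)       ≤⟨ *-mono-≤ X²≤ X²≤ ⟩
    (a * Y) * (a * Y)       ≡⟨ regroup a Y ⟩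
    a ^ 2 * (Y * Y)         ≤⟨ *-monoʳ-≤ (a ^ 2) Y²≤ ⟩
    a ^ 2 * (b * X)         ≡⟨ swap (a ^ 2) b X ⟩
    X * (a ^ 2 * b)         ∎)
    where
    open ≤-Reasoning
    X = energy A B A
    Y = energy B A B
    a = energy A A A
    b = energy B B B
    X²≤ : X * X ≤ a * Y
    X²≤ = subst (λ k → k * k ≤ a * Y) (sym (energy-rotate A B)) (energy-cauchy-schwarz {A} {A} {B} hA hB)
    Y²≤ : Y * Y ≤ b * X
    Y²≤ = subst (λ k → k * k ≤ b * X) (sym (energy-rotate B A)) (energy-cauchy-schwarz {B} {B} {A} hB hA)
    fourth : ∀ x → x * (x * (x * (x * 1))) ≡ (x * x) * (x * x)
    fourth = ℕ-ring
    regroup : ∀ a y → (a * y) * (a * y) ≡ a * (a * 1) * (y * y)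
    regroup = ℕ-ring
    swap : ∀ a b x → a * (b * x) ≡ x * (a * b)
    swap = ℕ-ring
    cancel : ∀ x {k} → x * x ^ 3 ≤ x * k → x ^ 3 ≤ k
    cancel zero        _ = z≤n
    cancel x@(suc _) h = *-cancelˡ-≤ x h

  -- The cube of Cauchy-Schwarz gives Z⁶ ≤ (a² b) (c² b), whose right side is the square of a b c.
  energy-hölder₃ : ∀ {A B C} → Units A → Units B → Units C →
    energy A B C ^ 3 ≤ energy A A A * energy B B B * energy C C C
  energy-hölder₃ {A} {B} {C} hA hB hC = square-cancel-≤ (begin
    Z ^ 3 * Z ^ 3                             ≡⟨ sixth Z ⟩
    (Z * Z) ^ 3                               ≤⟨ ^-monoˡ-≤ 3 (energy-cauchy-schwarz {A} {B} {C} hA hC) ⟩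
    (energy A B A * energy C B C) ^ 3         ≡⟨ ^-distribʳ-* (energy A B A) (energy C B C) 3 ⟩
    energy A B A ^ 3 * energy C B C ^ 3       ≤⟨ *-mono-≤ (energy-hölder₂ hA hB) (energy-hölder₂ hC hB) ⟩
    (a ^ 2 * b) * (c ^ 2 * b)                 ≡⟨ regroup a b c ⟩
    (a * b * c) * (a * b * c)                 ∎)
    where
    open ≤-Reasoning
    Z = energy A B C
    a = energy A A A
    b = energy B B B
    c = energy C C C
    sixth : ∀ z → z * (z * (z * 1)) * (z * (z * (z * 1))) ≡ z * z * (z * z * (z * z * 1))
    sixth = ℕ-ring
    regroup : ∀ a b c → (a * (a * 1) * b) * (c * (c * 1) * b) ≡ (a * b * c) * (a * b * c)
    regroup = ℕ-ring

  products³ : List ℤ → List ℤ → List ℤ → List Fraction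
  products³ A B C = map (λ (a , b , c) → a *ᶻ b *ᶻ c , 1ℤ) (cartesianProduct A (cartesianProduct B C))

  products³-unit : ∀ A B C → UnitDenominators (products³ A B C)
  products³-unit A B C f∈ with _ , _ , refl ← ∈-map⁻ _ f∈ = unit-1

  length-products³ : ∀ A B C → length (products³ A B C) ≡ length A * length B * length C
  length-products³ A B C = trans (length-map _ (cartesianProduct A (cartesianProduct B C)))
    (trans (length-cartesianProduct A (cartesianProduct B C))
      (trans (cong (length A *_) (length-cartesianProduct B C)) (sym (*-assoc (length A) (length B) (length C)))))

  coincidences-products³ : ∀ A B C → coincidences (products³ A B C) (products³ A B C) ≡ energy A B C
  coincidences-products³ A B C = trans (trans (expand _) (∑-cong A λ a → ∑-cong B λ b → ∑-cong C λ c →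
    trans (expand _) (∑-cong A λ a′ → ∑-cong B λ b′ → ∑-cong C λ c′ →
      cong₂ (λ z w → 𝟙 (p∣? (z -ᶻ w))) (ℤ.*-identityʳ (a *ᶻ b *ᶻ c)) (ℤ.*-identityʳ (a′ *ᶻ b′ *ᶻ c′))))) (productEnergy≡energy A B C)
    where
    expand : ∀ f → ∑ (products³ A B C) f ≡ ∑ A λ a → ∑ B λ b → ∑ C λ c → f (a *ᶻ b *ᶻ c , 1ℤ)
    expand f = trans (∑-map _ (cartesianProduct A (cartesianProduct B C)) f) (∑-cartesianProduct³ A B C _)

  ∑-products³-bound : ∀ A B C → {P : ℕ → Set} (P? : ∀ w → Dec (P w)) →
    (∀ {a b c w} → a ∈ A → b ∈ B → c ∈ C → w < p → + p ∣ᶻ a *ᶻ b *ᶻ c -ᶻ + w → P w) →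
    (length A * length B * length C) * (length A * length B * length C) ≤
      ∑ residues (λ w → 𝟙 (P? w)) * energy A B C
  ∑-products³-bound A B C {P} P? h = subst₂ (λ k e → k * k ≤ ∑ residues (λ w → 𝟙 (P? w)) * e)
    (length-products³ A B C) (coincidences-products³ A B C) (support-bound (products³-unit A B C) P? supported)
    where
    supported : ∀ w → w < p → 1 ≤ representations (products³ A B C) w → P w
    supported w w<p pos with f , f∈ , pos′ ← ∑-positive (products³ A B C) pos
      with (a , b , c) , t∈ , refl ← ∈-map⁻ _ f∈
      with a∈ , bc∈ ← ∈-cartesianProduct⁻ A (cartesianProduct B C) t∈
      with b∈ , c∈ ← ∈-cartesianProduct⁻ B C bc∈ =
      h a∈ b∈ c∈ w<p (subst (λ z → + p ∣ᶻ a *ᶻ b *ᶻ c -ᶻ z) (ℤ.*-identityʳ (+ w)) (𝟙-positive (p∣? _) pos′))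

  translates : ∀ N → 1 ≤ N → ℤ → List ℤ
  translates N 1≤N L = map (λ x → L +ᶻ + x) (interval N 1≤N)

  energy≡cubicEnergy : ∀ N 1≤N L → let A = translates N 1≤N L in energy A A A ≡ cubicEnergy N 1≤N p L
  energy≡cubicEnergy N 1≤N L = trans (sym (productEnergy≡energy A A A)) (trans
    (trans (∑-map u I _) (∑-cong I λ a → trans (∑-map u I _) (∑-cong I λ b → trans (∑-map u I _) (∑-cong I λ c →
      trans (∑-map u I _) (∑-cong I λ a′ → trans (∑-map u I _) (∑-cong I λ b′ → trans (∑-map u I _) (∑-cong I λ c′ →
        p∣-flip (flip (u a *ᶻ u b *ᶻ u c) (u a′ *ᶻ u b′ *ᶻ u c′)))))))))
    (sym (trans (∑-cartesianProduct³ I I I _) (∑-cong I λ a → ∑-cong I λ b → ∑-cong I λ c → ∑-cartesianProduct³ I I I _))))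
    where
    A = translates N 1≤N L
    I = interval N 1≤N
    u : ℕ → ℤ
    u x = L +ᶻ + x
    flip : ∀ z w → z -ᶻ w ≡ -ᶻ (w -ᶻ z)
    flip = ℤ-ring

-- From subsets of the residue classes to lists of integers

∣S∣≡∑ : ∀ {n} (S : Subset n) → ∣ S ∣ ≡ ∑ (allFin n) λ x → 𝟙 (x ∈? S)
∣S∣≡∑ [] = refl
∣S∣≡∑ {suc n} (s ∷ S) = trans (split s) (cong (λ k → 𝟙 (Fin.zero ∈? (s ∷ S)) + k) (sym tail))
  where
  split : ∀ s → ∣ s ∷ S ∣ ≡ 𝟙 (Fin.zero ∈? (s ∷ S)) + ∑ (allFin n) λ x → 𝟙 (x ∈? S)
  split inside  = cong suc (∣S∣≡∑ S)
  split outside = ∣S∣≡∑ S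
  tail : ∑ (List.tabulate Fin.suc) (λ x → 𝟙 (x ∈? (s ∷ S))) ≡ ∑ (allFin n) λ x → 𝟙 (x ∈? S)
  tail = trans (cong (λ xs → ∑ xs λ x → 𝟙 (x ∈? (s ∷ S))) (sym (map-tabulate (λ x → x) Fin.suc)))
    (trans (∑-map Fin.suc (allFin n) _) (∑-cong (allFin n) λ x → 𝟙-cong (Fin.suc x ∈? (s ∷ S)) (x ∈? S) drop-there there))

∈-tabulate⁻ : ∀ {n} {P : Fin n → Set} (P? : ∀ x → Dec (P x)) {x} → x ∈ˢ tabulate (λ x → does (P? x)) → P x
∈-tabulate⁻ {P = P} P? {x} x∈ = holds (P? x) (trans (sym (lookup∘tabulate _ x)) ([]=⇒lookup x∈))
  where
  holds : (d : Dec (P x)) → does d ≡ true → P x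
  holds (yes px) _ = px

∈-tabulate⁺ : ∀ {n} {P : Fin n → Set} (P? : ∀ x → Dec (P x)) {x} → P x → x ∈ˢ tabulate (λ x → does (P? x))
∈-tabulate⁺ P? {x} px = lookup⇒[]= x _ (trans (lookup∘tabulate _ x) (dec-true (P? x) px))

module _ {p : ℕ} .{{_ : NonZero p}} where

  IsProduct : Subset p → Subset p → Subset p → Fin p → Set
  IsProduct I J K w = ∃[ x ] ∃[ y ] ∃[ z ] x ∈ˢ I × y ∈ˢ J × z ∈ˢ K × w ≡ x ⊗ y ⊗ z

  isProduct? : ∀ I J K w → Dec (IsProduct I J K w)
  isProduct? I J K w = any? λ x → any? λ y → any? λ z →
    x ∈? I ×-dec y ∈? J ×-dec z ∈? K ×-dec w ≟ᶠ x ⊗ y ⊗ z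

  ∈-productSet⁻ : ∀ I J K {w} → w ∈ˢ productSet I J K → IsProduct I J K w
  ∈-productSet⁻ I J K = ∈-tabulate⁻ (isProduct? I J K)

  ∈-productSet⁺ : ∀ I J K {w} → IsProduct I J K w → w ∈ˢ productSet I J K
  ∈-productSet⁺ I J K = ∈-tabulate⁺ (isProduct? I J K)

  -- Each element of the product set is hit by at least one triple of weight 1, and each triple hits
  -- exactly one residue class.
  productSet-bound : ∀ I J K → ∣ productSet I J K ∣ ≤ ∣ I ∣ * ∣ J ∣ * ∣ K ∣
  productSet-bound I J K = begin
    ∣ productSet I J K ∣
      ≡⟨ ∣S∣≡∑ (productSet I J K) ⟩
    ∑ F (λ w → 𝟙 (w ∈? productSet I J K))
      ≤⟨ ∑-mono F (λ w → 𝟙-≤ (w ∈? productSet I J K) (counted ∘ ∈-productSet⁻ I J K)) ⟩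
    ∑ F (λ w → ∑ ts λ t → weight t * 𝟙 (w ≟ᶠ product³ t))
      ≡⟨ ∑-swap F ts (λ w t → weight t * 𝟙 (w ≟ᶠ product³ t)) ⟩
    ∑ ts (λ t → ∑ F λ w → weight t * 𝟙 (w ≟ᶠ product³ t))
      ≡⟨ (∑-cong ts λ t → trans (∑-*ˡ F (weight t) (λ w → 𝟙 (w ≟ᶠ product³ t)))
           (trans (cong (weight t *_) (once (product³ t))) (*-identityʳ _))) ⟩
    ∑ ts weight
      ≡⟨ ∑-cartesianProduct³ F F F weight ⟩
    (∑ F λ x → ∑ F λ y → ∑ F λ z → 𝟙 (x ∈? I) * (𝟙 (y ∈? J) * 𝟙 (z ∈? K)))
      ≡⟨ (∑-cong F λ x → trans (∑-cong F λ y → ∑-*ˡ F (𝟙 (x ∈? I)) _) (∑-*ˡ F (𝟙 (x ∈? I)) _)) ⟩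
    (∑ F λ x → 𝟙 (x ∈? I) * ∑ F λ y → ∑ F λ z → 𝟙 (y ∈? J) * 𝟙 (z ∈? K))
      ≡⟨ ∑-*ʳ F _ _ ⟩
    (∑ F λ x → 𝟙 (x ∈? I)) * (∑ F λ y → ∑ F λ z → 𝟙 (y ∈? J) * 𝟙 (z ∈? K))
      ≡⟨ cong ((∑ F λ x → 𝟙 (x ∈? I)) *_) (sym (∑-*-∑ F F (λ y → 𝟙 (y ∈? J)) (λ z → 𝟙 (z ∈? K)))) ⟩
    (∑ F λ x → 𝟙 (x ∈? I)) * ((∑ F λ y → 𝟙 (y ∈? J)) * (∑ F λ z → 𝟙 (z ∈? K)))
      ≡⟨ sym (cong₂ _*_ (∣S∣≡∑ I) (cong₂ _*_ (∣S∣≡∑ J) (∣S∣≡∑ K))) ⟩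
    ∣ I ∣ * (∣ J ∣ * ∣ K ∣)
      ≡⟨ sym (*-assoc (∣ I ∣) (∣ J ∣) (∣ K ∣)) ⟩
    ∣ I ∣ * ∣ J ∣ * ∣ K ∣ ∎
    where
    open ≤-Reasoning
    F = allFin p
    ts = cartesianProduct F (cartesianProduct F F)
    weight : Fin p × Fin p × Fin p → ℕ
    weight (x , y , z) = 𝟙 (x ∈? I) * (𝟙 (y ∈? J) * 𝟙 (z ∈? K))
    product³ : Fin p × Fin p × Fin p → Fin p
    product³ (x , y , z) = x ⊗ y ⊗ z
    once : ∀ v → ∑ F (λ w → 𝟙 (w ≟ᶠ v)) ≡ 1
    once v = trans (∑-single (Unique.allFin⁺ p) (∈-allFin v) λ {w} _ w≢v → 𝟙-no (w ≟ᶠ v) w≢v) (𝟙-yes (v ≟ᶠ v) refl)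
    counted : ∀ {w} → IsProduct I J K w → 1 ≤ ∑ ts λ t → weight t * 𝟙 (w ≟ᶠ product³ t)
    counted {w} (x , y , z , x∈ , y∈ , z∈ , eq) = ≤-trans
      (≤-reflexive (sym (cong₂ _*_ (cong₂ _*_ (𝟙-yes (x ∈? I) x∈) (cong₂ _*_ (𝟙-yes (y ∈? J) y∈) (𝟙-yes (z ∈? K) z∈)))
        (𝟙-yes (w ≟ᶠ product³ (x , y , z)) eq))))
      (∑-≥ (λ t → weight t * 𝟙 (w ≟ᶠ product³ t)) (∈-cartesianProduct⁺ (∈-allFin x) (∈-cartesianProduct⁺ (∈-allFin y) (∈-allFin z))))

  module _ (pp : Prime p) where
    open Energy pp

    residue-congruent : ∀ z → + p ∣ᶻ z -ᶻ + toℕ (residue {p} z)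
    residue-congruent z = ℤ∣.divides q (trans (cong (λ k → z -ᶻ + k) (toℕ-fromℕ< (n%ℕd<d z p)))
      (trans (cong (_-ᶻ + (z %ℕ p)) (a≡a%ℕn+[a/ℕn]*n z p)) (cancel (+ (z %ℕ p)) (q *ᶻ + p))))
      where
      q = z ℤ./ℕ p
      cancel : ∀ r z → r +ᶻ z -ᶻ r ≡ z
      cancel = ℤ-ring

    ⊗-congruent : ∀ (x y : Fin p) {a b} → + p ∣ᶻ a -ᶻ + toℕ x → + p ∣ᶻ b -ᶻ + toℕ y → + p ∣ᶻ a *ᶻ b -ᶻ + toℕ (x ⊗ y)
    ⊗-congruent x y {a} {b} hx hy = subst (+ p ∣ᶻ_) (regroup a b (+ toℕ x) (+ toℕ y) (+ toℕ (x ⊗ y)))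
      (ℤ∣.∣m∣n⇒∣m+n (ℤ∣.∣m∣n⇒∣m+n (ℤ∣.∣n⇒∣m*n b hx) (ℤ∣.∣n⇒∣m*n (+ toℕ x) hy)) reduce)
      where
      regroup : ∀ a b x y z → b *ᶻ (a -ᶻ x) +ᶻ x *ᶻ (b -ᶻ y) +ᶻ (x *ᶻ y -ᶻ z) ≡ a *ᶻ b -ᶻ z
      regroup = ℤ-ring
      m = toℕ x * toℕ y
      cancel : ∀ r z → r +ᶻ z -ᶻ r ≡ z
      cancel = ℤ-ring
      reduce : + p ∣ᶻ + toℕ x *ᶻ + toℕ y -ᶻ + toℕ (x ⊗ y)
      reduce = ℤ∣.divides (+ (m / p)) (trans (cong₂ _-ᶻ_ (sym (ℤ.pos-* (toℕ x) (toℕ y))) (cong +_ (toℕ-fromℕ< (m%n<n m p))))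
        (trans (cong (λ k → + k -ᶻ + (m % p)) (m≡m%n+[m/n]*n m p)) (trans (cancel (+ (m % p)) (+ (m / p * p))) (ℤ.pos-* (m / p) p))))

    residue-injective : ∀ L {i j} → i < p → j < p → residue {p} (L +ᶻ + i) ≡ residue (L +ᶻ + j) → i ≡ j
    residue-injective L {i} {j} i<p j<p eq = residue-unique i<p j<p (subst (+ p ∣ᶻ_)
      (regroup L (+ i) (+ j) (+ toℕ (residue {p} (L +ᶻ + j))))
      (ℤ∣.∣m∣n⇒∣m-n (subst (λ r → + p ∣ᶻ L +ᶻ + i -ᶻ + toℕ r) eq (residue-congruent (L +ᶻ + i))) (residue-congruent (L +ᶻ + j))))
      where
      regroup : ∀ L i j r → L +ᶻ i -ᶻ r -ᶻ (L +ᶻ j -ᶻ r) ≡ i -ᶻ j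
      regroup = ℤ-ring

    -- Since N < p, the classes of L + 1, ..., L + N are distinct. The pairs (x , i) with x the
    -- class of L + i are counted in both orders.
    interval-size : ∀ (I : Subset p) L N → 1 ≤ N → N < p →
      (∀ x → x ∈ˢ I → ∃[ i ] 1 ≤ i × i ≤ N × x ≡ residue (L +ᶻ + i)) →
      (∀ x → ∃[ i ] 1 ≤ i × i ≤ N × x ≡ residue (L +ᶻ + i) → x ∈ˢ I) → ∣ I ∣ ≡ N
    interval-size I L N 1≤N N<p ∈⇒ ⇒∈ = begin
      ∣ I ∣                                                       ≡⟨ ∣S∣≡∑ I ⟩
      ∑ F (λ x → 𝟙 (x ∈? I))
        ≡⟨ ∑-cong F (λ x → sym (member x (x ∈? I))) ⟩
      ∑ F (λ x → ∑ X λ i → 𝟙 (x ≟ᶠ residue (L +ᶻ + i)))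
        ≡⟨ ∑-swap F X (λ x i → 𝟙 (x ≟ᶠ residue (L +ᶻ + i))) ⟩
      ∑ X (λ i → ∑ F λ x → 𝟙 (x ≟ᶠ residue (L +ᶻ + i)))
        ≡⟨ ∑-cong X (λ i → once (residue (L +ᶻ + i))) ⟩
      ∑ X (λ _ → 1)                                               ≡⟨ ∑-const X 1 ⟩
      length X * 1                                                ≡⟨ *-identityʳ _ ⟩
      length X                                                    ≡⟨ length-applyUpTo suc N ⟩
      N                                                           ∎
      where
      open ≡-Reasoning
      F = allFin p
      X = interval N 1≤N
      once : ∀ v → ∑ F (λ w → 𝟙 (w ≟ᶠ v)) ≡ 1
      once v = trans (∑-single (Unique.allFin⁺ p) (∈-allFin v) λ {w} _ w≢v → 𝟙-no (w ≟ᶠ v) w≢v) (𝟙-yes (v ≟ᶠ v) refl)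
      bounds : ∀ {i} → i ∈ X → 1 ≤ i × i ≤ N
      bounds = ∈-interval N 1≤N
      member : ∀ x (d : Dec (x ∈ˢ I)) → ∑ X (λ i → 𝟙 (x ≟ᶠ residue (L +ᶻ + i))) ≡ 𝟙 d
      member x (no x∉) = ∑-all-zero X λ {i} i∈ → 𝟙-no (x ≟ᶠ residue (L +ᶻ + i)) λ eq →
        x∉ (⇒∈ x (i , proj₁ (bounds i∈) , proj₂ (bounds i∈) , eq))
      member x (yes x∈) = found (∈⇒ x x∈)
        where
        found : ∃[ i ] 1 ≤ i × i ≤ N × x ≡ residue (L +ᶻ + i) → ∑ X (λ i → 𝟙 (x ≟ᶠ residue (L +ᶻ + i))) ≡ 1
        found (suc i , _ , i<N , eq) = trans
          (∑-single (interval-unique N 1≤N) (∈-applyUpTo⁺ suc i<N) λ {j} j∈ j≢i → 𝟙-no (x ≟ᶠ residue (L +ᶻ + j)) λ eq′ →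
            j≢i (residue-injective L (≤-<-trans (proj₂ (bounds j∈)) N<p) (≤-<-trans i<N N<p) (trans (sym eq′) eq)))
          (𝟙-yes (x ≟ᶠ residue (L +ᶻ + suc i)) eq)

    ∑-residues-subset : (S : Subset p) (S? : ∀ w → Dec (∃[ x ] toℕ x ≡ w × x ∈ˢ S)) →
      ∑ residues (λ w → 𝟙 (S? w)) ≤ ∣ S ∣
    ∑-residues-subset S S? = begin
      ∑ residues (λ w → 𝟙 (S? w))
        ≤⟨ ∑-mono residues (λ w → 𝟙-≤ (S? w) (counted w)) ⟩
      ∑ residues (λ w → ∑ (allFin p) λ x → 𝟙 (x ∈? S) * 𝟙 (w ℕ.≟ toℕ x))
        ≡⟨ ∑-swap residues (allFin p) (λ w x → 𝟙 (x ∈? S) * 𝟙 (w ℕ.≟ toℕ x)) ⟩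
      ∑ (allFin p) (λ x → ∑ residues λ w → 𝟙 (x ∈? S) * 𝟙 (w ℕ.≟ toℕ x))
        ≡⟨ (∑-cong (allFin p) λ x → trans (∑-*ˡ residues (𝟙 (x ∈? S)) _) (trans (cong (𝟙 (x ∈? S) *_) (once x)) (*-identityʳ _))) ⟩
      ∑ (allFin p) (λ x → 𝟙 (x ∈? S))
        ≡⟨ sym (∣S∣≡∑ S) ⟩
      ∣ S ∣ ∎
      where
      open ≤-Reasoning
      once : ∀ (x : Fin p) → ∑ residues (λ w → 𝟙 (w ℕ.≟ toℕ x)) ≡ 1
      once x = trans (∑-single (Unique.upTo⁺ p) (∈-upTo⁺ (toℕ<n x)) λ {w} _ w≢x → 𝟙-no (w ℕ.≟ toℕ x) w≢x)
        (𝟙-yes (toℕ x ℕ.≟ toℕ x) refl)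
      counted : ∀ w → ∃[ x ] toℕ x ≡ w × x ∈ˢ S → 1 ≤ ∑ (allFin p) λ x → 𝟙 (x ∈? S) * 𝟙 (w ℕ.≟ toℕ x)
      counted w (x , eq , x∈) = ≤-trans
        (≤-reflexive (sym (cong₂ _*_ (𝟙-yes (x ∈? S) x∈) (𝟙-yes (w ℕ.≟ toℕ x) (sym eq)))))
        (∑-≥ (λ x → 𝟙 (x ∈? S) * 𝟙 (w ℕ.≟ toℕ x)) (∈-allFin x))

    -- The residues represented by products a b c all lie in the product set, whose size therefore
    -- bounds the support in Cauchy-Schwarz.
    productSet-energy : ∀ I J K (A B C : List ℤ) →
      (∀ {a} → a ∈ A → residue a ∈ˢ I) → (∀ {b} → b ∈ B → residue b ∈ˢ J) → (∀ {c} → c ∈ C → residue c ∈ˢ K) →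
      (length A * length B * length C) * (length A * length B * length C) ≤ ∣ productSet I J K ∣ * energy A B C
    productSet-energy I J K A B C hA hB hC = ≤-trans (∑-products³-bound A B C S? member)
      (*-monoˡ-≤ (energy A B C) (∑-residues-subset (productSet I J K) S?))
      where
      S? : ∀ w → Dec (∃[ x ] toℕ x ≡ w × x ∈ˢ productSet I J K)
      S? w = any? λ x → (toℕ x ℕ.≟ w) ×-dec (x ∈? productSet I J K)
      subtract : ∀ z v w → z -ᶻ v -ᶻ (z -ᶻ w) ≡ w -ᶻ v
      subtract = ℤ-ring
      member : ∀ {a b c w} → a ∈ A → b ∈ B → c ∈ C → w < p → + p ∣ᶻ a *ᶻ b *ᶻ c -ᶻ + w →
        ∃[ x ] toℕ x ≡ w × x ∈ˢ productSet I J K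
      member {a} {b} {c} {w} a∈ b∈ c∈ w<p h = v , sym (residue-unique w<p (toℕ<n v)
          (subst (+ p ∣ᶻ_) (subtract (a *ᶻ b *ᶻ c) (+ toℕ v) (+ w)) (ℤ∣.∣m∣n⇒∣m-n congruent h)))
        , ∈-productSet⁺ I J K (residue a , residue b , residue c , hA a∈ , hB b∈ , hC c∈ , refl)
        where
        v = residue a ⊗ residue b ⊗ residue c
        congruent : + p ∣ᶻ a *ᶻ b *ᶻ c -ᶻ + toℕ v
        congruent = ⊗-congruent (residue a ⊗ residue b) (residue c) {a *ᶻ b} {c}
          (⊗-congruent (residue a) (residue b) {a} {b} (residue-congruent a) (residue-congruent b)) (residue-congruent c)

-- Rational constants and exponents

module ℚ-Exp = Exp (CommutativeRing.commutativeSemiring ℚ.+-*-commutativeRing)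

fromℕ-* : ∀ a b → fromℕ (a * b) ≡ fromℕ a ℚ.* fromℕ b
fromℕ-* a b = ℚ.toℚᵘ-injective (begin
  ℚ.toℚᵘ (fromℕ (a * b))                        ≈⟨ ℚ.toℚᵘ-fromℚᵘ (mkℚᵘ (+ (a * b)) 0) ⟩
  mkℚᵘ (+ (a * b)) 0                            ≈⟨ *≡* (cong (_*ᶻ 1ℤ) (ℤ.pos-* a b)) ⟩
  mkℚᵘ (+ a) 0 ℚᵘ.* mkℚᵘ (+ b) 0
    ≈⟨ ℚᵘ.*-cong (ℚᵘ.≃-sym (ℚ.toℚᵘ-fromℚᵘ (mkℚᵘ (+ a) 0))) (ℚᵘ.≃-sym (ℚ.toℚᵘ-fromℚᵘ (mkℚᵘ (+ b) 0))) ⟩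
  ℚ.toℚᵘ (fromℕ a) ℚᵘ.* ℚ.toℚᵘ (fromℕ b)        ≈⟨ ℚᵘ.≃-sym (ℚ.toℚᵘ-homo-* (fromℕ a) (fromℕ b)) ⟩
  ℚ.toℚᵘ (fromℕ a ℚ.* fromℕ b)                  ∎)
  where open ℚᵘ.≃-Reasoning

fromℕ-mono-≤ : ∀ {a b} → a ≤ b → fromℕ a ℚ.≤ fromℕ b
fromℕ-mono-≤ {a} {b} a≤b = ℚ.toℚᵘ-cancel-≤ (begin
  ℚ.toℚᵘ (fromℕ a)  ≃⟨ ℚ.toℚᵘ-fromℚᵘ (mkℚᵘ (+ a) 0) ⟩
  mkℚᵘ (+ a) 0      ≤⟨ *≤* (ℤ.*-monoʳ-≤-nonNeg 1ℤ (ℤ.+≤+ a≤b)) ⟩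
  mkℚᵘ (+ b) 0      ≃⟨ ℚᵘ.≃-sym (ℚ.toℚᵘ-fromℚᵘ (mkℚᵘ (+ b) 0)) ⟩
  ℚ.toℚᵘ (fromℕ b)  ∎)
  where open ℚᵘ.≤-Reasoning

fromℕ-^ : ∀ a n → fromℕ (a ^ n) ≡ fromℕ a ^ℚ n
fromℕ-^ a zero    = refl
fromℕ-^ a (suc n) = trans (fromℕ-* a (a ^ n)) (cong (fromℕ a ℚ.*_) (fromℕ-^ a n))

1^ℚ : ∀ n → 1ℚ ^ℚ n ≡ 1ℚ
1^ℚ zero    = refl
1^ℚ (suc n) = trans (ℚ.*-identityˡ _) (1^ℚ n)

^ℚ-nonNegative : ∀ {c} → 0ℚ ℚ.≤ c → ∀ n → 0ℚ ℚ.≤ c ^ℚ n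
^ℚ-nonNegative 0≤c zero    = fromℕ-mono-≤ (z≤n {1})
^ℚ-nonNegative {c} 0≤c (suc n) = subst (ℚ._≤ c ℚ.* c ^ℚ n) (ℚ.*-zeroʳ c)
  (ℚ.*-monoˡ-≤-nonNeg c {{ℚ.nonNegative 0≤c}} (^ℚ-nonNegative 0≤c n))

-- The constant c is chosen as the reciprocal of a natural number, so that inequalities with c^v
-- reduce to inequalities with C^v among natural numbers.
module Reciprocal (C-1 : ℕ) where

  C : ℕ
  C = suc C-1

  c : ℚ
  c = + 1 ℚ./ C

  0<c : 0ℚ ℚ.< c
  0<c = ℚ.toℚᵘ-cancel-< (ℚᵘ.<-respʳ-≃ (ℚᵘ.≃-sym (ℚ.toℚᵘ-fromℚᵘ (mkℚᵘ (+ 1) C-1)))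
    (*<* (ℤ.+<+ (s≤s z≤n))))

  c*C≡1 : c ℚ.* fromℕ C ≡ 1ℚ
  c*C≡1 = ℚ.toℚᵘ-injective (begin
    ℚ.toℚᵘ (c ℚ.* fromℕ C)              ≈⟨ ℚ.toℚᵘ-homo-* c (fromℕ C) ⟩
    ℚ.toℚᵘ c ℚᵘ.* ℚ.toℚᵘ (fromℕ C)
      ≈⟨ ℚᵘ.*-cong (ℚ.toℚᵘ-fromℚᵘ (mkℚᵘ (+ 1) C-1)) (ℚ.toℚᵘ-fromℚᵘ (mkℚᵘ (+ C) 0)) ⟩
    mkℚᵘ (+ 1) C-1 ℚᵘ.* mkℚᵘ (+ C) 0    ≈⟨ *≡* (cong +_ (equal-sides C-1)) ⟩
    ℚ.toℚᵘ 1ℚ                           ∎)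
    where
    open ℚᵘ.≃-Reasoning
    equal-sides : ∀ n → 1 * suc n * 1 ≡ 1 * (suc n * 1)
    equal-sides = ℕ-ring

  scale : ∀ v {X Y} → X ≤ C ^ v * Y → c ^ℚ v ℚ.* fromℕ X ℚ.≤ fromℕ Y
  scale v {X} {Y} h = begin
    c ^ℚ v ℚ.* fromℕ X
      ≤⟨ ℚ.*-monoˡ-≤-nonNeg (c ^ℚ v) {{ℚ.nonNegative (^ℚ-nonNegative (ℚ.<⇒≤ 0<c) v)}} (fromℕ-mono-≤ h) ⟩
    c ^ℚ v ℚ.* fromℕ (C ^ v * Y)
      ≡⟨ cong (c ^ℚ v ℚ.*_) (trans (fromℕ-* (C ^ v) Y) (cong (ℚ._* fromℕ Y) (fromℕ-^ C v))) ⟩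
    c ^ℚ v ℚ.* (fromℕ C ^ℚ v ℚ.* fromℕ Y)  ≡⟨ sym (ℚ.*-assoc (c ^ℚ v) (fromℕ C ^ℚ v) (fromℕ Y)) ⟩
    c ^ℚ v ℚ.* fromℕ C ^ℚ v ℚ.* fromℕ Y    ≡⟨ cong (ℚ._* fromℕ Y) (sym (ℚ-Exp.^-distrib-* c (fromℕ C) v)) ⟩
    (c ℚ.* fromℕ C) ^ℚ v ℚ.* fromℕ Y       ≡⟨ cong (λ z → z ^ℚ v ℚ.* fromℕ Y) c*C≡1 ⟩
    1ℚ ^ℚ v ℚ.* fromℕ Y                    ≡⟨ cong (ℚ._* fromℕ Y) (1^ℚ v) ⟩
    1ℚ ℚ.* fromℕ Y                         ≡⟨ ℚ.*-identityˡ (fromℕ Y) ⟩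
    fromℕ Y                                ∎
    where open ℚ.≤-Reasoning

^-cancelˡ-≤ : ∀ k .{{_ : NonZero k}} {m n} → m ^ k ≤ n ^ k → m ≤ n
^-cancelˡ-≤ k h = ≮⇒≥ λ n<m → <⇒≱ (^-monoˡ-< k n<m) h

-- For u / v ≤ j / k this reads n^(u/v) ≤ n^(j/k) ≤ X; the comparison takes place after raising both
-- sides to the power `k`.
^-fraction-≤ : ∀ {n X j k u v} .{{_ : NonZero k}} → 1 ≤ n → n ^ j ≤ X ^ k → u * k ≤ v * j → n ^ u ≤ X ^ v
^-fraction-≤ {n} {X} {j} {k} {u} {v} 1≤n h uk≤vj = ^-cancelˡ-≤ k (begin
  (n ^ u) ^ k  ≡⟨ ^-*-assoc n u k ⟩
  n ^ (u * k)  ≤⟨ ^-monoʳ-≤ n {{>-nonZero 1≤n}} uk≤vj ⟩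
  n ^ (v * j)  ≡⟨ cong (n ^_) (*-comm v j) ⟩
  n ^ (j * v)  ≡⟨ sym (^-*-assoc n j v) ⟩
  (n ^ j) ^ v  ≤⟨ ^-monoˡ-≤ v h ⟩
  (X ^ k) ^ v  ≡⟨ ^-*-assoc X k v ⟩
  X ^ (k * v)  ≡⟨ cong (X ^_) (*-comm k v) ⟩
  X ^ (v * k)  ≡⟨ sym (^-*-assoc X v k) ⟩
  (X ^ v) ^ k  ∎)
  where open ≤-Reasoning

scaledPowerℚ : ∀ C-1 n m j r → (let open Reciprocal C-1) → 1 ≤ n → n ^ j ≤ (C * m) ^ suc j →
  (∀ u → ↥ r ≡ + u → u * suc j ≤ ↧ₙ r * j) → ScaledPowerℚ≤ c n r m
scaledPowerℚ C-1 n m j (mkℚ (+ u) d _) 1≤n h small = subst₂ (λ s t → c ^ℚ suc d ℚ.* s ℚ.≤ t) (fromℕ-^ n u) (fromℕ-^ m (suc d))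
  (scale (suc d) (≤-trans (^-fraction-≤ {n} {C * m} {j} {suc j} {u} {suc d} 1≤n h (small u refl))
    (≤-reflexive (^-distribʳ-* C m (suc d)))))
  where open Reciprocal C-1
-- For a negative exponent the claim reduces to 1 ≤ C^v m^v n^u. Here m is positive, since m = 0
-- would make the right side of `h` vanish while n^j ≥ 1.
scaledPowerℚ C-1 n m j (mkℚ -[1+ u ] d _) 1≤n h _ = subst₂ ℚ._≤_ (ℚ.*-identityʳ (c ^ℚ suc d))
  (trans (fromℕ-* (m ^ suc d) (n ^ suc u)) (cong₂ ℚ._*_ (fromℕ-^ m (suc d)) (fromℕ-^ n (suc u))))
  (scale (suc d) {1} {m ^ suc d * n ^ suc u}
    (*-mono-≤ (1≤x^ (s≤s z≤n) (suc d)) (*-mono-≤ (1≤x^ (1≤m m h) (suc d)) (1≤x^ 1≤n (suc u)))))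
  where
  open Reciprocal C-1
  1≤x^ : ∀ {x} → 1 ≤ x → ∀ k → 1 ≤ x ^ k
  1≤x^ {x} 1≤x k = m^n>0 x {{>-nonZero 1≤x}} k
  1≤m : ∀ m → n ^ j ≤ (C * m) ^ suc j → 1 ≤ m
  1≤m zero    h = contradiction (≤-trans (1≤x^ 1≤n j) (≤-trans h (≤-reflexive (cong (λ z → z * z ^ j) (*-zeroʳ C))))) λ ()
  1≤m (suc m) _ = s≤s z≤n

open ℝ

-- δ = (1 + a) / (1 + j) is a rational with 0 < δ < ε, so 1 - ε < 1 - δ ≤ j / (1 + j).
below-complement : ∀ ε → Positive ε → ∃[ j ] (∀ r → lower (1ℚ ⊖ ε) r → ∀ u → ↥ r ≡ + u → u * suc j ≤ ↧ₙ r * j)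
below-complement ε 0<ε with lower-open ε 0<ε
... | mkℚ (+ zero) j cop , ℚ.*<* (ℤ.+<+ ()) , _
... | mkℚ +[1+ a ] j cop , _ , δ<ε = j , bound
  where
  δ = mkℚ +[1+ a ] j cop
  bound : ∀ r → lower (1ℚ ⊖ ε) r → ∀ u → ↥ r ≡ + u → u * suc j ≤ ↧ₙ r * j
  bound r@(mkℚ _ d _) ε<1-r u refl = ≤-trans (m≤n+m (u * suc j) (a * suc d)) (≤-trans (n≤1+n _) (+-cancelˡ-≤ (suc d) _ _
    (≤-trans (≤-reflexive (regroup (suc d) a u (suc j))) (≤-trans cross-multiplied (≤-reflexive (unfold (suc d) j))))))
    where
    δ<1-r : δ ℚ.< 1ℚ ℚ.- r
    δ<1-r = ℚ.≰⇒> λ 1-r≤δ → let q , δ<q , q<ε = lower-open ε δ<ε in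
      disjoint ε (lower-closed ε (ℚ.≤-<-trans 1-r≤δ δ<q) q<ε , ε<1-r)
    δ+r<1 : δ ℚ.+ r ℚ.< 1ℚ
    δ+r<1 = subst (δ ℚ.+ r ℚ.<_)
      (trans (ℚ.+-assoc 1ℚ (ℚ.- r) r) (trans (cong (1ℚ ℚ.+_) (ℚ.+-inverseˡ r)) (ℚ.+-identityʳ 1ℚ)))
      (ℚ.+-monoˡ-< r δ<1-r)
    unnormalised : mkℚᵘ +[1+ a ] j ℚᵘ.+ mkℚᵘ (+ u) d ℚᵘ.< mkℚᵘ (+ 1) 0
    unnormalised = ℚᵘ.<-respˡ-≃ (ℚ.toℚᵘ-homo-+ δ r) (ℚ.toℚᵘ-mono-< δ+r<1)
    cross-multiplied : suc a * suc d + u * suc j < suc j * suc d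
    cross-multiplied = ℤ.drop‿+<+ (subst₂ ℤ._<_
      (trans (ℤ.*-identityʳ _) (cong₂ _+ᶻ_ (sym (ℤ.pos-* (suc a) (suc d))) (sym (ℤ.pos-* u (suc j)))))
      (ℤ.*-identityˡ _) (ℚᵘ.drop-*<* unnormalised))
    regroup : ∀ v a u k → v + suc (a * v + u * k) ≡ suc (suc a * v + u * k)
    regroup = ℕ-ring
    unfold : ∀ v j → suc j * v ≡ v + v * j
    unfold = ℕ-ring

-- Subintervals and the lower bound for the product set

-- Division by 3 gains 3⁸ = 6561 ≥ 1000, and N ≤ 3 M + 2 ≤ 5 M once M ≥ 1. For N < 3 the witness is
-- M = 1, whose condition 1000 < p is the origin of p₀ = 1001.
subinterval-length : ∀ {N p} → 1 ≤ N → N ^ 8 < p → 1001 ≤ p →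
  ∃[ M ] 1 ≤ M × M ≤ N × N ≤ 5 * M × 1000 * M ^ 8 < p
subinterval-length {N} {p} 1≤N N^8<p 1001≤p = [ tiny , cut ]′ (<-≤-connex N 3)
  where
  open ≤-Reasoning
  M = N / 3
  tiny : N < 3 → ∃[ M ] 1 ≤ M × M ≤ N × N ≤ 5 * M × 1000 * M ^ 8 < p
  tiny N<3 = 1 , ≤-refl , 1≤N , ≤-trans (<⇒≤ N<3) (m≤m+n 3 2) , 1001≤p
  third-power : ∀ M → M * 3 ≤ N → 1000 * M ^ 8 ≤ N ^ 8
  third-power M h = begin
    1000 * M ^ 8     ≤⟨ *-monoˡ-≤ (M ^ 8) (toWitness {a? = 1000 ≤? 3 ^ 8} _) ⟩
    3 ^ 8 * M ^ 8    ≡⟨ *-comm (3 ^ 8) (M ^ 8) ⟩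
    M ^ 8 * 3 ^ 8    ≡⟨ sym (^-distribʳ-* M 3 8) ⟩
    (M * 3) ^ 8      ≤⟨ ^-monoˡ-≤ 8 h ⟩
    N ^ 8            ∎
  split : ∀ M → M * 2 + M * 3 ≡ 5 * M
  split = ℕ-ring
  N≤5M : 1 ≤ M → N ≤ 5 * M
  N≤5M 0<M = begin
    N                ≡⟨ m≡m%n+[m/n]*n N 3 ⟩
    N % 3 + M * 3    ≤⟨ +-monoˡ-≤ (M * 3) (s≤s⁻¹ (m%n<n N 3)) ⟩
    2 + M * 3        ≤⟨ +-monoˡ-≤ (M * 3) (*-monoˡ-≤ 2 0<M) ⟩
    M * 2 + M * 3    ≡⟨ split M ⟩
    5 * M            ∎
  cut : 3 ≤ N → ∃[ M ] 1 ≤ M × M ≤ N × N ≤ 5 * M × 1000 * M ^ 8 < p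
  cut 3≤N = M , m≥n⇒m/n>0 3≤N , m/n≤m N 3 , N≤5M (m≥n⇒m/n>0 3≤N) , ≤-<-trans (third-power M (m/n*n≤m N 3)) N^8<p

module _ {p : ℕ} .{{_ : NonZero p}} (pp : Prime p) where
  open Energy pp

  record LargeSubinterval (I : Subset p) : Set where
    field
      L     : ℤ
      N     : ℕ
      1≤N   : 1 ≤ N
      short : 1000 * N ^ 8 < p
      large : ∣ I ∣ ≤ 5 * N
      units : ∀ x → 1 ≤ x → x ≤ N → Unit (L +ᶻ + x)
      ⊆I    : ∀ x → 1 ≤ x → x ≤ N → residue (L +ᶻ + x) ∈ˢ I

    elements : List ℤ
    elements = translates N 1≤N L

    elements-units : Units elements
    elements-units a∈ with x , x∈ , refl ← ∈-map⁻ (λ x → L +ᶻ + x) a∈ =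
      let 1≤x , x≤N = ∈-interval N 1≤N x∈ in units x 1≤x x≤N

    elements⊆I : ∀ {a} → a ∈ elements → residue a ∈ˢ I
    elements⊆I a∈ with x , x∈ , refl ← ∈-map⁻ (λ x → L +ᶻ + x) a∈ =
      let 1≤x , x≤N = ∈-interval N 1≤N x∈ in ⊆I x 1≤x x≤N

    length-elements : length elements ≡ N
    length-elements = trans (length-map (λ x → L +ᶻ + x) (interval N 1≤N)) (length-applyUpTo suc N)

    elements-energy : ∀ m → 1 ≤ m → energy elements elements elements ^ m ≤ energyConstant m * N ^ (3 * m + 24)
    elements-energy m 1≤m = subst (λ e → e ^ m ≤ energyConstant m * N ^ (3 * m + 24)) (sym (energy≡cubicEnergy N 1≤N L))
      (cubicEnergy-bounded N 1≤N pp short L units m 1≤m)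

  largeSubinterval : ∀ {I} → 1001 ≤ p → IsInterval I → ∣ I ∣ ^ 8 < p → LargeSubinterval I
  largeSubinterval {I} 1001≤p (L , N , 1≤N , N<p , units , ∈⇔) ∣I∣^8<p =
    let M , 1≤M , M≤N , N≤5M , short = subinterval-length 1≤N (subst (λ k → k ^ 8 < p) size ∣I∣^8<p) 1001≤p in record
      { L = L ; N = M ; 1≤N = 1≤M ; short = short
      ; large = subst (_≤ 5 * M) (sym size) N≤5M
      ; units = λ x 1≤x x≤M h → units x 1≤x (≤-trans x≤M M≤N) (ℤ∣.∣⇒∣ᵤ h)
      ; ⊆I = λ x 1≤x x≤M → Equivalence.from (∈⇔ _) (x , 1≤x , ≤-trans x≤M M≤N , refl)
      }
    where
    size : ∣ I ∣ ≡ N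
    size = interval-size pp I L N 1≤N N<p (λ x → Equivalence.to (∈⇔ x)) (λ x → Equivalence.from (∈⇔ x))

private
  ^-distribʳ-*³ : ∀ a b c n → (a * b * c) ^ n ≡ a ^ n * b ^ n * c ^ n
  ^-distribʳ-*³ a b c n = trans (^-distribʳ-* (a * b) c n) (cong (_* c ^ n) (^-distribʳ-* a b n))

energy-power : ∀ m t D E {e₁ e₂ e₃ N₁ N₂ N₃} → E ^ 3 ≤ e₁ * e₂ * e₃ →
  e₁ ^ m ≤ D * N₁ ^ t → e₂ ^ m ≤ D * N₂ ^ t → e₃ ^ m ≤ D * N₃ ^ t →
  E ^ (3 * m) ≤ D ^ 3 * (N₁ * N₂ * N₃) ^ t
energy-power m t D E {e₁} {e₂} {e₃} {N₁} {N₂} {N₃} hE h₁ h₂ h₃ = begin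
  E ^ (3 * m)                                   ≡⟨ sym (^-*-assoc E 3 m) ⟩
  (E ^ 3) ^ m                                   ≤⟨ ^-monoˡ-≤ m hE ⟩
  (e₁ * e₂ * e₃) ^ m                            ≡⟨ ^-distribʳ-*³ e₁ e₂ e₃ m ⟩
  e₁ ^ m * e₂ ^ m * e₃ ^ m                      ≤⟨ *-mono-≤ (*-mono-≤ h₁ h₂) h₃ ⟩
  D * N₁ ^ t * (D * N₂ ^ t) * (D * N₃ ^ t)      ≡⟨ regroup D (N₁ ^ t) (N₂ ^ t) (N₃ ^ t) ⟩
  D ^ 3 * (N₁ ^ t * N₂ ^ t * N₃ ^ t)            ≡⟨ cong (D ^ 3 *_) (sym (^-distribʳ-*³ N₁ N₂ N₃ t)) ⟩
  D ^ 3 * (N₁ * N₂ * N₃) ^ t                    ∎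
  where
  open ≤-Reasoning
  regroup : ∀ D a b c → D * a * (D * b) * (D * c) ≡ D * (D * (D * 1)) * (a * b * c)
  regroup = ℕ-ring

-- From n^(2t) ≤ P^t E^t ≤ P^t B n^(t + d) the power n^(t + d) is cancelled; 2t - (t + d) = s.
support-power : ∀ d t s B P E n → t ≡ s + d → 1 ≤ n → n * n ≤ P * E →
  E ^ t ≤ B * n ^ (t + d) → n ^ s ≤ P ^ t * B
support-power d t s B P E n t≡s+d 1≤n n²≤PE hE = *-cancelˡ-≤ (n ^ (t + d)) {{m^n≢0 n (t + d) {{>-nonZero 1≤n}}}} (begin
  n ^ (t + d) * n ^ s            ≡⟨ sym (^-distribˡ-+-* n (t + d) s) ⟩
  n ^ (t + d + s)
    ≡⟨ cong (n ^_) (trans (+-assoc t d s) (cong (λ k → t + k) (trans (+-comm d s) (sym t≡s+d)))) ⟩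
  n ^ (t + t)                     ≡⟨ ^-distribˡ-+-* n t t ⟩
  n ^ t * n ^ t                   ≡⟨ sym (^-distribʳ-* n n t) ⟩
  (n * n) ^ t                     ≤⟨ ^-monoˡ-≤ t n²≤PE ⟩
  (P * E) ^ t                     ≡⟨ ^-distribʳ-* P E t ⟩
  P ^ t * E ^ t                   ≤⟨ *-monoʳ-≤ (P ^ t) hE ⟩
  P ^ t * (B * n ^ (t + d))      ≡⟨ regroup (P ^ t) B (n ^ (t + d)) ⟩
  n ^ (t + d) * (P ^ t * B)      ∎)
  where
  open ≤-Reasoning
  regroup : ∀ a b c → a * (b * c) ≡ c * (a * b)
  regroup = ℕ-ring

-- Takes the d-th root after passing from n to S. Since B ≥ 1, it is at most its own power of
-- exponent k d, so the constant moves into the base.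
rescale-power : ∀ c d j k {B P n S} .{{_ : NonZero c}} .{{_ : NonZero d}} .{{_ : NonZero k}} → 1 ≤ B → j ≤ k →
  S ≤ c * n → n ^ (j * d) ≤ P ^ (k * d) * B → S ^ j ≤ (c * B * P) ^ k
rescale-power c d j k {B} {P} {n} {S} 1≤B j≤k S≤ h = ^-cancelˡ-≤ d (begin
  (S ^ j) ^ d                             ≡⟨ ^-*-assoc S j d ⟩
  S ^ (j * d)                             ≤⟨ ^-monoˡ-≤ (j * d) S≤ ⟩
  (c * n) ^ (j * d)                       ≡⟨ ^-distribʳ-* c n (j * d) ⟩
  c ^ (j * d) * n ^ (j * d)               ≤⟨ *-mono-≤ (^-monoʳ-≤ c (*-monoˡ-≤ d j≤k)) h ⟩
  c ^ t * (P ^ t * B)                     ≤⟨ *-monoʳ-≤ (c ^ t) (*-monoʳ-≤ (P ^ t) B≤B^t) ⟩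
  c ^ t * (P ^ t * B ^ t)                 ≡⟨ regroup (c ^ t) (P ^ t) (B ^ t) ⟩
  c ^ t * B ^ t * P ^ t                   ≡⟨ sym (^-distribʳ-*³ c B P t) ⟩
  (c * B * P) ^ t                         ≡⟨ sym (^-*-assoc (c * B * P) k d) ⟩
  ((c * B * P) ^ k) ^ d                   ∎)
  where
  open ≤-Reasoning
  t = k * d
  B≤B^t : B ≤ B ^ t
  B≤B^t = ≤-trans (≤-reflexive (sym (*-identityʳ B)))
    (^-monoʳ-≤ B {{>-nonZero 1≤B}} {1} {t} (*-mono-≤ (>-nonZero⁻¹ k) (>-nonZero⁻¹ d)))
  regroup : ∀ a b c → a * (b * c) ≡ a * c * b
  regroup = ℕ-ring

-- The cube comes from the three diagonal energies in Hölder's inequality; the successor makes the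
-- constant positive.
supportConstant : ℕ → ℕ
supportConstant j = suc (energyConstant (8 * suc j)) ^ 3

productSet-lower : ∀ {p} .{{_ : NonZero p}} (pp : Prime p) {I J K : Subset p} →
  LargeSubinterval pp I → LargeSubinterval pp J → LargeSubinterval pp K → ∀ j →
  (∣ I ∣ * ∣ J ∣ * ∣ K ∣) ^ j ≤ (125 * supportConstant j * ∣ productSet I J K ∣) ^ suc j
productSet-lower pp {I} {J} {K} subI subJ subK j =
  -- 125 = 5³, as each subinterval keeps at least a fifth of its interval. With m = 8 (j + 1) the
  -- exponent 3 m of the energy bound is 24 (j + 1), so the loss 24 leaves 24 j and the common
  -- factor 24 cancels.
  rescale-power 125 24 j (suc j) {B} {P} {n} (m^n>0 (suc (energyConstant m)) 3) (n≤1+n j)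
    (≤-trans (*-mono-≤ (*-mono-≤ (large subI) (large subJ)) (large subK)) (≤-reflexive (regroup (N subI) (N subJ) (N subK))))
    (support-power 24 (suc j * 24) (j * 24) B P E n (+-comm 24 (j * 24))
      (*-mono-≤ (*-mono-≤ (1≤N subI) (1≤N subJ)) (1≤N subK)) n²≤PE E-bound)
  where
  open Energy pp
  open LargeSubinterval
  m = 8 * suc j
  B = supportConstant j
  P = ∣ productSet I J K ∣
  n = N subI * N subJ * N subK
  E = energy (elements subI) (elements subJ) (elements subK)
  regroup : ∀ a b c → 5 * a * (5 * b) * (5 * c) ≡ 125 * (a * b * c)
  regroup = ℕ-ring
  lengths : length (elements subI) * length (elements subJ) * length (elements subK) ≡ n
  lengths = cong₂ _*_ (cong₂ _*_ (length-elements subI) (length-elements subJ)) (length-elements subK)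
  n²≤PE : n * n ≤ P * E
  n²≤PE = subst (λ k → k * k ≤ P * E) lengths
    (productSet-energy pp I J K (elements subI) (elements subJ) (elements subK)
      (elements⊆I subI) (elements⊆I subJ) (elements⊆I subK))
  e : ∀ {S} → LargeSubinterval pp S → ℕ
  e sub = energy (elements sub) (elements sub) (elements sub)
  bound : ∀ {S} (sub : LargeSubinterval pp S) → e sub ^ m ≤ suc (energyConstant m) * N sub ^ (3 * m + 24)
  bound sub = ≤-trans (elements-energy sub m (s≤s z≤n)) (*-monoˡ-≤ (N sub ^ (3 * m + 24)) (n≤1+n (energyConstant m)))
  exponent : ∀ k → 3 * (8 * k) ≡ k * 24
  exponent = ℕ-ring
  E-bound : E ^ (suc j * 24) ≤ B * n ^ (suc j * 24 + 24)
  E-bound = subst (λ t → E ^ t ≤ B * n ^ (t + 24)) (exponent (suc j))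
    (energy-power m (3 * m + 24) (suc (energyConstant m)) E {e subI} {e subJ} {e subK} {N subI} {N subJ} {N subK}
      (energy-hölder₃ {elements subI} {elements subJ} {elements subK}
        (elements-units subI) (elements-units subJ) (elements-units subK))
      (bound subI) (bound subJ) (bound subK))

corollary2 : (ε : ℝ) → Positive ε →
    ∃[ p₀ ] ∃[ c ] 0ℚ ℚ.< c ×
    ((p : ℕ) .{{_ : NonZero p}} → Prime p → p₀ ≤ p →
    (I₁ I₂ I₃ : Subset p) →
    IsInterval I₁ → IsInterval I₂ → IsInterval I₃ →
    ∣ I₁ ∣ ^ 8 < p → ∣ I₂ ∣ ^ 8 < p → ∣ I₃ ∣ ^ 8 < p →
    ScaledPower≤ c (∣ I₁ ∣ * ∣ I₂ ∣ * ∣ I₃ ∣) (1ℚ ⊖ ε) ∣ productSet I₁ I₂ I₃ ∣ ×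
    ∣ productSet I₁ I₂ I₃ ∣ ≤ ∣ I₁ ∣ * ∣ I₂ ∣ * ∣ I₃ ∣)
corollary2 ε 0<ε = 1001 , Reciprocal.c C-1 , Reciprocal.0<c C-1 , λ p pp 1001≤p I₁ I₂ I₃ int₁ int₂ int₃ short₁ short₂ short₃ →
  let sub₁ = largeSubinterval pp 1001≤p int₁ short₁
      sub₂ = largeSubinterval pp 1001≤p int₂ short₂
      sub₃ = largeSubinterval pp 1001≤p int₃ short₃
  in (λ r r<1-ε → scaledPowerℚ C-1 (∣ I₁ ∣ * ∣ I₂ ∣ * ∣ I₃ ∣) (∣ productSet I₁ I₂ I₃ ∣) j r
       (*-mono-≤ (*-mono-≤ (nonempty pp int₁) (nonempty pp int₂)) (nonempty pp int₃))
       (≤-trans (productSet-lower pp sub₁ sub₂ sub₃ j)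
         (^-monoˡ-≤ (suc j) (*-monoˡ-≤ (∣ productSet I₁ I₂ I₃ ∣) (n≤1+n C-1))))
       (below r r<1-ε))
   , productSet-bound I₁ I₂ I₃
  where
  j = proj₁ (below-complement ε 0<ε)
  below = proj₂ (below-complement ε 0<ε)
  C-1 = 125 * supportConstant j
  nonempty : ∀ {p} .{{_ : NonZero p}} (pp : Prime p) {I : Subset p} → IsInterval I → 1 ≤ ∣ I ∣
  nonempty pp {I} (L , N , 1≤N , N<p , units , ∈⇔) = subst (1 ≤_)
    (sym (interval-size pp I L N 1≤N N<p (λ x → Equivalence.to (∈⇔ x)) (λ x → Equivalence.from (∈⇔ x)))) 1≤N
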